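{- There is no algorithm that, for every first-order sentence $\varphi$ of vocabulary $\{E\}$ such that $\mathrm{Graph}_{\mathrm{fin}}(\varphi)$ is closed under induced subgraphs, decides whether $\varphi$ is equivalent on finite graphs to a universal sentence (i.e. whether there is a universal sentence $\mu$ with $\mathrm{Graph}_{\mathrm{fin}}(\varphi)=\mathrm{Graph}_{\mathrm{fin}}(\mu)$).
   Context: Graphs are $\{E\}$-structures with $E$ binary, irreflexive and symmetric; induced subgraphs are as usual. $\mathrm{Graph}_{\mathrm{fin}}(\varphi)$ is the class of finite graphs that are models of $\varphi$. A first-order formula is universal if it is built from atomic and negated atomic formulas using $\wedge$, $\vee$ and universal quantifiers $\forall$ (equivalently, up to equivalence, of the form $\forall x_1\ldots\forall x_k\,\mu_0$ with $\mu_0$ quantifier-free). -}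

module Defs where

open import Data.Nat using (ℕ; zero; suc; _+_; _*_; _<_)
open import Data.Fin using (Fin; toℕ)
open import Data.Vec using (Vec; []; _∷_; lookup)
open import Data.Bool using (Bool; true; false; T)
open import Data.Product using (_×_; Σ; ∃; _,_)
open import Data.Sum using (_⊎_)
open import Data.Empty using (⊥)
open import Relation.Nullary using (¬_)
open import Relation.Binary.PropositionalEquality using (_≡_)
open import Function.Definitions using (Injective)

record Graph : Set where
  field
    pred-size : ℕ
    adj       : Fin (suc pred-size) → Fin (suc pred-size) → Bool
    irrefl    : ∀ x → adj x x ≡ false
    symm      : ∀ x y → adj x y ≡ adj y x

  V : Set
  V = Fin (suc pred-size)

open Graph public

_≤ind_ : Graph → Graph → Set
H ≤ind G = Σ (V H → V G) λ f →
  Injective _≡_ _≡_ f × (∀ x y → adj H x y ≡ adj G (f x) (f y))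

data Formula (n : ℕ) : Set where
  _≐_   : Fin n → Fin n → Formula n
  E     : Fin n → Fin n → Formula n
  ¬'_   : Formula n → Formula n
  _∧'_  : Formula n → Formula n → Formula n
  _∨'_  : Formula n → Formula n → Formula n
  ∀'_   : Formula (suc n) → Formula n
  ∃'_   : Formula (suc n) → Formula n

Sentence : Set
Sentence = Formula 0

extend : ∀ {n} {A : Set} → A → (Fin n → A) → Fin (suc n) → A
extend a ρ Fin.zero    = a
extend a ρ (Fin.suc i) = ρ i

Sat : ∀ {n} (G : Graph) → (Fin n → V G) → Formula n → Set
Sat G ρ (x ≐ y)   = ρ x ≡ ρ y
Sat G ρ (E x y)   = T (adj G (ρ x) (ρ y))
Sat G ρ (¬' φ)    = ¬ Sat G ρ φ
Sat G ρ (φ ∧' ψ)  = Sat G ρ φ × Sat G ρ ψ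
Sat G ρ (φ ∨' ψ)  = Sat G ρ φ ⊎ Sat G ρ ψ
Sat G ρ (∀' φ)    = ∀ (a : V G) → Sat G (extend a ρ) φ
Sat G ρ (∃' φ)    = Σ (V G) λ a → Sat G (extend a ρ) φ

empty-env : {A : Set} → Fin 0 → A
empty-env ()

_⊨_ : Graph → Sentence → Set
G ⊨ φ = Sat G empty-env φ

ClosedUnderInducedSubgraphs : Sentence → Set
ClosedUnderInducedSubgraphs φ = ∀ (G H : Graph) → H ≤ind G → G ⊨ φ → H ⊨ φ

data IsAtomic {n : ℕ} : Formula n → Set where
  at-eq : ∀ x y → IsAtomic (x ≐ y)
  at-E  : ∀ x y → IsAtomic (E x y)

data IsUniversal : {n : ℕ} → Formula n → Set where
  u-atom    : ∀ {n} {φ : Formula n} → IsAtomic φ → IsUniversal φ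
  u-negatom : ∀ {n} {φ : Formula n} → IsAtomic φ → IsUniversal (¬' φ)
  u-and     : ∀ {n} {φ ψ : Formula n} → IsUniversal φ → IsUniversal ψ → IsUniversal (φ ∧' ψ)
  u-or      : ∀ {n} {φ ψ : Formula n} → IsUniversal φ → IsUniversal ψ → IsUniversal (φ ∨' ψ)
  u-all     : ∀ {n} {φ : Formula (suc n)} → IsUniversal φ → IsUniversal (∀' φ)

FinEquiv : Sentence → Sentence → Set
FinEquiv φ ψ = ∀ (G : Graph) → (G ⊨ φ → G ⊨ ψ) × (G ⊨ ψ → G ⊨ φ)

EquivToUniversal : Sentence → Set
EquivToUniversal φ = Σ Sentence λ μ → IsUniversal μ × FinEquiv φ μ

tri : ℕ → ℕ
tri zero    = zero
tri (suc n) = suc n + tri n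

pair : ℕ → ℕ → ℕ
pair a b = tri (a + b) + a

code : ∀ {n} → Formula n → ℕ
code (x ≐ y)  = pair 0 (pair (toℕ x) (toℕ y))
code (E x y)  = pair 1 (pair (toℕ x) (toℕ y))
code (¬' φ)   = pair 2 (code φ)
code (φ ∧' ψ) = pair 3 (pair (code φ) (code ψ))
code (φ ∨' ψ) = pair 4 (pair (code φ) (code ψ))
code (∀' φ)   = pair 5 (code φ)
code (∃' φ)   = pair 6 (code φ)

data PR : ℕ → Set where
  zer  : ∀ {k} → PR k
  succ : PR 1
  proj : ∀ {k} → Fin k → PR k
  comp : ∀ {k m} → PR m → Vec (PR k) m → PR k
  prec : ∀ {k} → PR k → PR (suc (suc k)) → PR (suc k)
  mu   : ∀ {k} → PR (suc k) → PR k

mutual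
  data _⟨_⟩⇓_ : ∀ {k} → PR k → Vec ℕ k → ℕ → Set where
    ev-zer  : ∀ {k} {xs : Vec ℕ k} → zer ⟨ xs ⟩⇓ 0
    ev-succ : ∀ {x} → succ ⟨ x ∷ [] ⟩⇓ suc x
    ev-proj : ∀ {k} {i : Fin k} {xs} → proj i ⟨ xs ⟩⇓ lookup xs i
    ev-comp : ∀ {k m} {f : PR m} {gs : Vec (PR k) m} {xs ys y} →
              gs ⟨ xs ⟩⇓* ys → f ⟨ ys ⟩⇓ y → comp f gs ⟨ xs ⟩⇓ y
    ev-prec0 : ∀ {k} {f : PR k} {g} {xs y} →
               f ⟨ xs ⟩⇓ y → prec f g ⟨ 0 ∷ xs ⟩⇓ y
    ev-precS : ∀ {k} {f : PR k} {g} {n xs r y} →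
               prec f g ⟨ n ∷ xs ⟩⇓ r → g ⟨ n ∷ r ∷ xs ⟩⇓ y →
               prec f g ⟨ suc n ∷ xs ⟩⇓ y
    ev-mu   : ∀ {k} {f : PR (suc k)} {xs n} →
              f ⟨ n ∷ xs ⟩⇓ 0 →
              (∀ m → m < n → Σ ℕ λ v → f ⟨ m ∷ xs ⟩⇓ suc v) →
              mu f ⟨ xs ⟩⇓ n

  data _⟨_⟩⇓*_ : ∀ {k m} → Vec (PR k) m → Vec ℕ k → Vec ℕ m → Set where
    ev-[] : ∀ {k} {xs : Vec ℕ k} → [] ⟨ xs ⟩⇓* []
    ev-∷  : ∀ {k m} {g : PR k} {gs : Vec (PR k) m} {xs y ys} →
            g ⟨ xs ⟩⇓ y → gs ⟨ xs ⟩⇓* ys → (g ∷ gs) ⟨ xs ⟩⇓* (y ∷ ys)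

DecidesOn : PR 1 → (Sentence → Set) → (Sentence → Set) → Set
DecidesOn c Q P = ∀ (φ : Sentence) → Q φ →
  (c ⟨ code φ ∷ [] ⟩⇓ 1 × P φ) ⊎ (c ⟨ code φ ∷ [] ⟩⇓ 0 × ¬ P φ)

{-# OPTIONS --safe #-}
-- A sentence φ says that a graph lies in a universal class U and is not a "complete" member of U
-- storing a computation with output 1. Graphs in U look like linear orders in which every vertex
-- marks a position, and in a complete graph every position is taken: adding a vertex would leave
-- U. So a complete graph is never a proper induced subgraph of a graph in U, which makes φ closed
-- under induced subgraphs. If the computation never outputs 1, then φ is equivalent to U, hence
-- universal. If it does, then all large enough complete graphs storing its trace are minimal
-- non-models of φ, and since a universal sentence is refuted on boundedly many vertices, φ is not
-- equivalent to one. By diagonalisation φ can be chosen such that the computation is the run of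
-- the alleged decision procedure on φ itself.
module Submission where

open import Defs
open import Data.Bool using (Bool; true; false; T; not; _∧_; _∨_; if_then_else_)
import Data.Bool.Properties as Bool
open import Data.Bool.Properties using (T-≡; T-∧; T?; ∨-comm)
open import Data.Empty using (⊥; ⊥-elim)
open import Data.Fin using (Fin; zero; suc; toℕ; fromℕ; fromℕ<; inject₁; punchIn; punchOut; splitAt; _↑ˡ_; _↑ʳ_)
import Data.Fin.Properties as Fin
open import Data.List using (List; []; _∷_; _++_; length; applyUpTo)
import Data.List as List
open import Data.List.Membership.Propositional using (_∈_)
open import Data.List.Membership.Propositional.Properties
  using (∈-++⁺ˡ; ∈-++⁺ʳ; ∈-++⁻; ∈-map⁺; ∈-map⁻; ∈-applyUpTo⁺; ∈-applyUpTo⁻)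
open import Data.List.Properties using (length-++)
open import Data.List.Relation.Unary.All using (All; []; _∷_)
import Data.List.Relation.Unary.All as All
import Data.List.Relation.Unary.All.Properties as All
open import Data.List.Relation.Unary.Any using (here; there; index)
open import Data.List.Relation.Unary.Any.Properties using (lookup-index)
open import Data.Nat using (ℕ; zero; suc; _+_; _*_; _≤_; _<_; _<ᵇ_; _≡ᵇ_; z≤n; s≤s; s≤s⁻¹)
open import Data.Nat.Induction using (<-wellFounded)
import Data.Nat.Properties as ℕ
open import Data.Product using (Σ; ∃; ∃₂; _×_; _,_; proj₁; proj₂)
open import Data.Sum using (_⊎_; inj₁; inj₂)
import Data.Sum as Sum
open import Data.Sum.Function.Propositional using (_⊎-↔_)
open import Data.Unit using (tt)
open import Data.Vec using (Vec; []; _∷_; lookup; tabulate)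
open import Data.Vec.Functional using () renaming (_++_ to _⧺_)
open import Data.Vec.Functional.Properties using (lookup-++ˡ; lookup-++ʳ)
open import Data.Vec.Properties using (lookup∘tabulate)
open import Function using (_∘_; id; _↔_; Inverse)
open import Function.Bundles using (Equivalence)
open import Function.Construct.Composition using (_↔-∘_)
open import Function.Construct.Identity using (↔-id)
open import Induction.WellFounded using (Acc; acc)
open import Relation.Binary using (Tri; tri<; tri≈; tri>)
open import Relation.Binary.PropositionalEquality
  using (_≡_; _≢_; _≗_; refl; sym; trans; cong; cong₂; subst; subst₂)
open import Relation.Nullary using (¬_; Dec; yes; no; ¬?; contradiction)
open import Relation.Nullary.Decidable using (⌊_⌋; map′; _×-dec_; _⊎-dec_; decidable-stable)

-- Satisfaction

-- Universal conditions can forbid vertices but never demand them, and a graph offers neither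
-- constants nor colours. Names come from a guard, a 14-clique with one hub for each vertex type. U
-- imposes its conditions relative to every guard, so graphs without a guard lie in it vacuously;
-- completeness asks for one guard only. A row of vertices is kept from growing by marking positions
-- along another order, which must not grow either. Two orders close this circle: the numbers mark
-- positions along the `up` vertices and the `up` vertices along the numbers, while the ends of both
-- are unique in their types. The table rows are then marked along `up`. A graph in U, even a
-- complete one, need not be one of the intended graphs. Hence the formulas describing computations
-- are proved sound in arbitrary finite graphs, where a vertex stands for the number of its `upT`
-- neighbours; only their completeness is confined to the constructed graphs. A run has unboundedly
-- many values and a formula a fixed number of variables, which is why recursion and search need a
-- stored table.

Env : Graph → ℕ → Set
Env G n = Fin n → V G

infix 2 _⟺_
_⟺_ : Set → Set → Set
A ⟺ B = (A → B) × (B → A)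

extend-cong : ∀ {A : Set} {n} {a b : A} {ρ σ : Fin n → A} → a ≡ b → ρ ≗ σ →
              extend a ρ ≗ extend b σ
extend-cong p q zero    = p
extend-cong p q (suc i) = q i

map-extend : ∀ {A B : Set} {n} (f : A → B) {a} {ρ : Fin n → A} {σ : Fin n → B} →
             f ∘ ρ ≗ σ → f ∘ extend a ρ ≗ extend (f a) σ
map-extend f q zero    = refl
map-extend f q (suc i) = q i

Surjects : ∀ {A B : Set} → (A → B) → Set
Surjects f = ∀ v → ∃ λ u → f u ≡ v

-- The case f = id says that satisfaction depends only on the values of the environment.
Sat-iso : ∀ {n} {G H : Graph} ((f , _) : H ≤ind G) → Surjects f →
          ∀ {ρ : Env H n} {σ : Env G n} → f ∘ ρ ≗ σ → (φ : Formula n) →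
          Sat H ρ φ ⟺ Sat G σ φ
Sat-iso (f , inj , hom) sur q (x ≐ y) =
  (λ e → trans (sym (q x)) (trans (cong f e) (q y))) ,
  (λ e → inj (trans (q x) (trans e (sym (q y)))))
Sat-iso {G = G} (f , inj , hom) sur {ρ} q (E x y) = subst T eq , subst T (sym eq)
  where eq = trans (hom (ρ x) (ρ y)) (cong₂ (adj G) (q x) (q y))
Sat-iso e sur q (¬' φ) =
  (λ ¬s → ¬s ∘ proj₂ (Sat-iso e sur q φ)) , (λ ¬s → ¬s ∘ proj₁ (Sat-iso e sur q φ))
Sat-iso e sur q (φ ∧' ψ) with Sat-iso e sur q φ | Sat-iso e sur q ψ
... | f , f′ | g , g′ = (λ (a , b) → f a , g b) , (λ (a , b) → f′ a , g′ b)
Sat-iso e sur q (φ ∨' ψ) with Sat-iso e sur q φ | Sat-iso e sur q ψ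
... | f , f′ | g , g′ = Sum.map f g , Sum.map f′ g′
Sat-iso {G = G} e@(f , _) sur {ρ} {σ} q (∀' φ) =
  (λ s b → let a , fa≡b = sur b in
     proj₁ (Sat-iso e sur (λ i → trans (map-extend f q i) (extend-cong fa≡b (λ _ → refl) i)) φ) (s a)) ,
  (λ s a → proj₂ (Sat-iso e sur (map-extend f q) φ) (s (f a)))
Sat-iso {G = G} e@(f , _) sur q (∃' φ) =
  (λ (a , s) → f a , proj₁ (Sat-iso e sur (map-extend f q) φ) s) ,
  (λ (b , s) → let a , fa≡b = sur b in
     a , proj₂ (Sat-iso e sur (λ i → trans (map-extend f q i) (extend-cong fa≡b (λ _ → refl) i)) φ) s)

≤ind-refl : ∀ G → G ≤ind G
≤ind-refl G = id , id , λ _ _ → refl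

Sat-cong : ∀ {n} {G} {ρ σ : Env G n} → ρ ≗ σ → (φ : Formula n) → Sat G ρ φ → Sat G σ φ
Sat-cong {G = G} q φ = proj₁ (Sat-iso (≤ind-refl G) (λ v → v , refl) q φ)

Sat? : ∀ {n} G (ρ : Env G n) (φ : Formula n) → Dec (Sat G ρ φ)
Sat? G ρ (x ≐ y)  = ρ x Fin.≟ ρ y
Sat? G ρ (E x y)  = T? (adj G (ρ x) (ρ y))
Sat? G ρ (¬' φ)   = ¬? (Sat? G ρ φ)
Sat? G ρ (φ ∧' ψ) = Sat? G ρ φ ×-dec Sat? G ρ ψ
Sat? G ρ (φ ∨' ψ) = Sat? G ρ φ ⊎-dec Sat? G ρ ψ
Sat? G ρ (∀' φ)   = Fin.all? λ a → Sat? G (extend a ρ) φ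
Sat? G ρ (∃' φ)   = Fin.any? λ a → Sat? G (extend a ρ) φ

-- Universal formulas

universal-≤ind : ∀ {n} {G H : Graph} ((f , _) : H ≤ind G) {ρ : Env H n} {σ : Env G n} → f ∘ ρ ≗ σ →
                 {φ : Formula n} → IsUniversal φ → Sat G σ φ → Sat H ρ φ
universal-≤ind (f , inj , hom) q (u-atom (at-eq x y)) s = inj (trans (q x) (trans s (sym (q y))))
universal-≤ind {G = G} (f , inj , hom) {ρ} q (u-atom (at-E x y)) s =
  subst T (sym (trans (hom (ρ x) (ρ y)) (cong₂ (adj G) (q x) (q y)))) s
universal-≤ind (f , inj , hom) q (u-negatom (at-eq x y)) s e =
  s (trans (sym (q x)) (trans (cong f e) (q y)))
universal-≤ind {G = G} (f , inj , hom) {ρ} q (u-negatom (at-E x y)) s e =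
  s (subst T (trans (hom (ρ x) (ρ y)) (cong₂ (adj G) (q x) (q y))) e)
universal-≤ind e q (u-and u v) (s , t) = universal-≤ind e q u s , universal-≤ind e q v t
universal-≤ind e q (u-or u v) (inj₁ s) = inj₁ (universal-≤ind e q u s)
universal-≤ind e q (u-or u v) (inj₂ s) = inj₂ (universal-≤ind e q v s)
universal-≤ind e@(f , _) q (u-all u) s a = universal-≤ind e (map-extend f q) u (s (f a))

-- Implications compile to negated subformulas, whereas `IsUniversal` admits negation only at atoms.
-- The normal form bridges the two.
nnf : Bool → ∀ {n} → Formula n → Formula n
nnf true  (x ≐ y)  = x ≐ y
nnf false (x ≐ y)  = ¬' (x ≐ y)
nnf true  (E x y)  = E x y
nnf false (E x y)  = ¬' (E x y)
nnf b     (¬' φ)   = nnf (not b) φ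
nnf true  (φ ∧' ψ) = nnf true φ ∧' nnf true ψ
nnf false (φ ∧' ψ) = nnf false φ ∨' nnf false ψ
nnf true  (φ ∨' ψ) = nnf true φ ∨' nnf true ψ
nnf false (φ ∨' ψ) = nnf false φ ∧' nnf false ψ
nnf true  (∀' φ)   = ∀' nnf true φ
nnf false (∀' φ)   = ∃' nnf false φ
nnf true  (∃' φ)   = ∃' nnf true φ
nnf false (∃' φ)   = ∀' nnf false φ

nnf-true  : ∀ {n G} {ρ : Env G n} (φ : Formula n) → Sat G ρ (nnf true φ) ⟺ Sat G ρ φ
nnf-false : ∀ {n G} {ρ : Env G n} (φ : Formula n) → Sat G ρ (nnf false φ) ⟺ (¬ Sat G ρ φ)
nnf-true (x ≐ y)  = id , id
nnf-true (E x y)  = id , id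
nnf-true (¬' φ)   = nnf-false φ
nnf-true (φ ∧' ψ) with nnf-true φ | nnf-true ψ
... | f , f′ | g , g′ = (λ (a , b) → f a , g b) , (λ (a , b) → f′ a , g′ b)
nnf-true (φ ∨' ψ) with nnf-true φ | nnf-true ψ
... | f , f′ | g , g′ = Sum.map f g , Sum.map f′ g′
nnf-true (∀' φ)   = (λ s a → proj₁ (nnf-true φ) (s a)) , (λ s a → proj₂ (nnf-true φ) (s a))
nnf-true (∃' φ)   = (λ (a , s) → a , proj₁ (nnf-true φ) s) , (λ (a , s) → a , proj₂ (nnf-true φ) s)
nnf-false (x ≐ y)  = id , id
nnf-false (E x y)  = id , id
nnf-false {G = G} {ρ} (¬' φ) with nnf-true {ρ = ρ} φ
... | f , f′ = (λ s ¬s → ¬s (f s)) , (λ ¬¬s → f′ (decidable-stable (Sat? G ρ φ) ¬¬s))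
nnf-false {G = G} {ρ} (φ ∧' ψ) with nnf-false {ρ = ρ} φ | nnf-false {ρ = ρ} ψ
... | f , f′ | g , g′ = (λ { (inj₁ s) (a , _) → f s a ; (inj₂ s) (_ , b) → g s b }) , back
  where
  back : ¬ (Sat G ρ φ × Sat G ρ ψ) → _
  back ¬s with Sat? G ρ φ
  ... | yes a = inj₂ (g′ λ b → ¬s (a , b))
  ... | no ¬a = inj₁ (f′ ¬a)
nnf-false (φ ∨' ψ) with nnf-false φ | nnf-false ψ
... | f , f′ | g , g′ = (λ { (a , b) (inj₁ s) → f a s ; (a , b) (inj₂ s) → g b s }) ,
                        (λ ¬s → f′ (¬s ∘ inj₁) , g′ (¬s ∘ inj₂))
nnf-false {G = G} {ρ} (∀' φ) =
  (λ (a , s) t → proj₁ (nnf-false φ) s (t a)) ,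
  (λ ¬s → let a , t = Fin.¬∀⟶∃¬ _ _ (λ a → Sat? G (extend a ρ) φ) ¬s in a , proj₂ (nnf-false φ) t)
nnf-false (∃' φ) =
  (λ s (a , t) → proj₁ (nnf-false φ) (s a) t) , (λ ¬s a → proj₂ (nnf-false φ) (λ t → ¬s (a , t)))

-- isUniversal b φ: only universal quantifiers in nnf b φ.
isUniversal : Bool → ∀ {n} → Formula n → Bool
isUniversal b (x ≐ y)  = true
isUniversal b (E x y)  = true
isUniversal b (¬' φ)   = isUniversal (not b) φ
isUniversal b (φ ∧' ψ) = isUniversal b φ ∧ isUniversal b ψ
isUniversal b (φ ∨' ψ) = isUniversal b φ ∧ isUniversal b ψ
isUniversal b (∀' φ)   = b ∧ isUniversal b φ
isUniversal b (∃' φ)   = not b ∧ isUniversal b φ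

nnf-universal : ∀ b {n} (φ : Formula n) → T (isUniversal b φ) → IsUniversal (nnf b φ)
nnf-universal true  (x ≐ y)  _ = u-atom (at-eq x y)
nnf-universal false (x ≐ y)  _ = u-negatom (at-eq x y)
nnf-universal true  (E x y)  _ = u-atom (at-E x y)
nnf-universal false (E x y)  _ = u-negatom (at-E x y)
nnf-universal true  (¬' φ)   t = nnf-universal false φ t
nnf-universal false (¬' φ)   t = nnf-universal true φ t
nnf-universal true  (φ ∧' ψ) t =
  let p , q = Equivalence.to T-∧ t in u-and (nnf-universal true φ p) (nnf-universal true ψ q)
nnf-universal false (φ ∧' ψ) t =
  let p , q = Equivalence.to T-∧ t in u-or (nnf-universal false φ p) (nnf-universal false ψ q)
nnf-universal true  (φ ∨' ψ) t =
  let p , q = Equivalence.to T-∧ t in u-or (nnf-universal true φ p) (nnf-universal true ψ q)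
nnf-universal false (φ ∨' ψ) t =
  let p , q = Equivalence.to T-∧ t in u-and (nnf-universal false φ p) (nnf-universal false ψ q)
nnf-universal true  (∀' φ)   t = u-all (nnf-universal true φ t)
nnf-universal false (∃' φ)   t = u-all (nnf-universal false φ t)

∀-count : ∀ {n} {φ : Formula n} → IsUniversal φ → ℕ
∀-count (u-atom _)    = 0
∀-count (u-negatom _) = 0
∀-count (u-and u v)   = ∀-count u + ∀-count v
∀-count (u-or u v)    = ∀-count u + ∀-count v
∀-count (u-all u)     = suc (∀-count u)

Covers : ∀ {A B : Set} → (A → B) → List B → Set
Covers f W = ∀ {w} → w ∈ W → ∃ λ u → f u ≡ w

-- A false `∀'` contributes a vertex that falsifies it, a false conjunction the list of one false
-- conjunct, a false disjunction the lists of both. The bound depends on the formula only, not on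
-- the graph.
counterexample : ∀ {n G} {σ : Env G n} {φ : Formula n} (u : IsUniversal φ) → ¬ Sat G σ φ →
  ∃ λ W → length W ≤ ∀-count u ×
    (∀ {H} (e@(f , _) : H ≤ind G) → Covers f W → ∀ {ρ : Env H n} → f ∘ ρ ≗ σ → ¬ Sat H ρ φ)
counterexample {G = G} (u-atom (at-eq x y)) ¬s =
  [] , z≤n , λ (f , inj , hom) _ q e → ¬s (trans (sym (q x)) (trans (cong f e) (q y)))
counterexample {G = G} (u-atom (at-E x y)) ¬s =
  [] , z≤n , λ (f , inj , hom) _ {ρ} q e → ¬s (subst T (trans (hom (ρ x) (ρ y)) (cong₂ (adj G) (q x) (q y))) e)
counterexample (u-negatom (at-eq x y)) ¬s =
  [] , z≤n , λ (f , inj , hom) _ q ¬e → ¬s λ e → ¬e (inj (trans (q x) (trans e (sym (q y)))))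
counterexample {G = G} (u-negatom (at-E x y)) ¬s =
  [] , z≤n , λ (f , inj , hom) _ {ρ} q ¬e →
    ¬s λ e → ¬e (subst T (sym (trans (hom (ρ x) (ρ y)) (cong₂ (adj G) (q x) (q y)))) e)
counterexample {G = G} {σ} (u-and {φ = φ} u v) ¬s with Sat? G σ φ
... | no ¬a  = let W , l , c = counterexample u ¬a in
  W , ℕ.≤-trans l (ℕ.m≤m+n _ _) , λ e cov q (a , _) → c e cov q a
... | yes a = let W , l , c = counterexample v (λ b → ¬s (a , b)) in
  W , ℕ.≤-trans l (ℕ.m≤n+m _ _) , λ e cov q (_ , b) → c e cov q b
counterexample (u-or u v) ¬s =
  let W , l , c  = counterexample u (¬s ∘ inj₁)
      X , k , d = counterexample v (¬s ∘ inj₂) in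
  W ++ X ,
  ℕ.≤-trans (ℕ.≤-reflexive (length-++ W)) (ℕ.+-mono-≤ l k) ,
  λ { e cov q (inj₁ s) → c e (λ w → cov (∈-++⁺ˡ w)) q s
    ; e cov q (inj₂ s) → d e (λ w → cov (∈-++⁺ʳ W w)) q s }
counterexample {G = G} {σ} (u-all {φ = φ} u) ¬s
  with a , ¬t ← Fin.¬∀⟶∃¬ _ _ (λ a → Sat? G (extend a σ) φ) ¬s
  with W , l , c ← counterexample u ¬t =
  a ∷ W , s≤s l , λ e@(f , _) cov q s →
    let b , fb≡a = cov (here refl) in
    c e (λ w → cov (there w))
      (λ i → trans (map-extend f {b} q i) (extend-cong fb≡a (λ _ → refl) i)) (s b)

missing : ∀ {n} (W : List (Fin n)) → length W < n → ∃ λ v → ¬ v ∈ W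
missing {n} W l = Fin.¬∀⟶∃¬ n (_∈ W) (_∈? W) λ all →
  let i , j , i<j , eq = Fin.pigeonhole l (index ∘ all) in
  Fin.<⇒≢ i<j (trans (lookup-index (all i)) (trans (cong (List.lookup W) eq) (sym (lookup-index (all j)))))
  where
  open import Data.List.Membership.DecPropositional Fin._≟_ using (_∈?_)


-- Graphs have at least one vertex, so a deletion requires a second one.
vertex-deletion : (G : Graph) → 0 < pred-size G → (v : V G) →
  ∃ λ H → Σ (H ≤ind G) λ (f , _) → (∀ u → f u ≢ v) × (∀ w → w ≢ v → ∃ λ u → f u ≡ w)
vertex-deletion record { pred-size = suc k ; adj = a ; irrefl = i ; symm = s } _ v =
  record { pred-size = k
         ; adj       = λ x y → a (punchIn v x) (punchIn v y)
         ; irrefl    = λ x → i (punchIn v x)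
         ; symm      = λ x y → s (punchIn v x) (punchIn v y) } ,
  (punchIn v , (λ {x} {y} → Fin.punchIn-injective v x y) , λ _ _ → refl) ,
  Fin.punchInᵢ≢i v ,
  λ w w≢v → punchOut (w≢v ∘ sym) , Fin.punchIn-punchOut (w≢v ∘ sym)

-- A non-model with more vertices than a refutation of `μ` needs has a vertex outside the refuting
-- list. Deleting it leaves a non-model of `μ`, hence of `φ`, so a large non-model cannot be
-- minimal.
small-minimal-nonmodels : ∀ {φ μ : Sentence} (u : IsUniversal μ) → FinEquiv φ μ →
  (G : Graph) → suc (∀-count u) ≤ pred-size G → ¬ (G ⊨ φ) →
  ¬ (∀ H (e : H ≤ind G) → ¬ Surjects (proj₁ e) → H ⊨ φ)
small-minimal-nonmodels u eqv G big ¬φ proper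
  with W , l , c ← counterexample u (λ s → ¬φ (proj₂ (eqv G) s))
  with v , v∉W ← missing W (s≤s (ℕ.≤-trans l (ℕ.≤-trans (ℕ.n≤1+n _) big)))
  with H , e , avoid , cover ← vertex-deletion G (ℕ.≤-trans (s≤s z≤n) big) v =
  c e (λ {w} w∈W → cover w λ { refl → v∉W w∈W }) (λ ())
    (proj₁ (eqv H) (proper H e λ sur → avoid _ (proj₂ (sur v))))

-- Renaming of variables

lift : ∀ {m n} → (Fin m → Fin n) → Fin (suc m) → Fin (suc n)
lift σ zero    = zero
lift σ (suc i) = suc (σ i)

rename : ∀ {m n} → (Fin m → Fin n) → Formula m → Formula n
rename σ (x ≐ y)  = σ x ≐ σ y
rename σ (E x y)  = E (σ x) (σ y)
rename σ (¬' φ)   = ¬' rename σ φ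
rename σ (φ ∧' ψ) = rename σ φ ∧' rename σ ψ
rename σ (φ ∨' ψ) = rename σ φ ∨' rename σ ψ
rename σ (∀' φ)   = ∀' rename (lift σ) φ
rename σ (∃' φ)   = ∃' rename (lift σ) φ

extend-lift : ∀ {A : Set} {m n} {σ : Fin m → Fin n} {ρ : Fin n → A} {τ : Fin m → A} {a} →
              ρ ∘ σ ≗ τ → extend a ρ ∘ lift σ ≗ extend a τ
extend-lift q zero    = refl
extend-lift q (suc i) = q i

Sat-rename : ∀ {m n G} {σ : Fin m → Fin n} {ρ : Env G n} {τ : Env G m} → ρ ∘ σ ≗ τ →
             (φ : Formula m) → Sat G ρ (rename σ φ) ⟺ Sat G τ φ
Sat-rename q (x ≐ y) = (λ e → trans (sym (q x)) (trans e (q y))) ,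
                       (λ e → trans (q x) (trans e (sym (q y))))
Sat-rename {G = G} q (E x y) = subst T eq , subst T (sym eq)
  where eq = cong₂ (adj G) (q x) (q y)
Sat-rename q (¬' φ) = (_∘ proj₂ (Sat-rename q φ)) , (_∘ proj₁ (Sat-rename q φ))
Sat-rename q (φ ∧' ψ) with Sat-rename q φ | Sat-rename q ψ
... | f , f′ | g , g′ = (λ (a , b) → f a , g b) , (λ (a , b) → f′ a , g′ b)
Sat-rename q (φ ∨' ψ) with Sat-rename q φ | Sat-rename q ψ
... | f , f′ | g , g′ = Sum.map f g , Sum.map f′ g′
Sat-rename q (∀' φ) = (λ s a → proj₁ (Sat-rename (extend-lift q) φ) (s a)) ,
                      (λ s a → proj₂ (Sat-rename (extend-lift q) φ) (s a))
Sat-rename q (∃' φ) = (λ (a , s) → a , proj₁ (Sat-rename (extend-lift q) φ) s) ,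
                      (λ (a , s) → a , proj₂ (Sat-rename (extend-lift q) φ) s)

-- First-order logic with finite conjunctions and disjunctions, blocks of quantifiers and
-- explicit renamings, whose semantics unfolds to readable propositions.
infix  9 _==_ _~[_]_
infixr 7 _∧ᶠ_
infixr 6 _∨ᶠ_
infixr 5 _⇒_
data Fm : ℕ → Set where
  _==_           : ∀ {n} → Fin n → Fin n → Fm n
  _~[_]_         : ∀ {n} → Fin n → Bool → Fin n → Fm n
  ¬ᶠ_            : ∀ {n} → Fm n → Fm n
  _∧ᶠ_ _∨ᶠ_ _⇒_  : ∀ {n} → Fm n → Fm n → Fm n
  ⋀ ⋁            : ∀ {n k} → (Fin (suc k) → Fm n) → Fm n
  ∀ᶠ_ ∃ᶠ_        : ∀ {n} → Fm (suc n) → Fm n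
  ∀ⁿ ∃ⁿ          : ∀ k {n} → Fm (k + n) → Fm n
  ren            : ∀ {m n} → (Fin m → Fin n) → Fm m → Fm n

⟦_⟧ : ∀ {n} → Fm n → (G : Graph) → Env G n → Set
⟦ x == y ⟧  G ρ = ρ x ≡ ρ y
⟦ x ~[ b ] y ⟧ G ρ = adj G (ρ x) (ρ y) ≡ b
⟦ ¬ᶠ φ ⟧    G ρ = ¬ ⟦ φ ⟧ G ρ
⟦ φ ∧ᶠ ψ ⟧  G ρ = ⟦ φ ⟧ G ρ × ⟦ ψ ⟧ G ρ
⟦ φ ∨ᶠ ψ ⟧  G ρ = ⟦ φ ⟧ G ρ ⊎ ⟦ ψ ⟧ G ρ
⟦ φ ⇒ ψ ⟧   G ρ = ⟦ φ ⟧ G ρ → ⟦ ψ ⟧ G ρ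
⟦ ⋀ f ⟧     G ρ = ∀ i → ⟦ f i ⟧ G ρ
⟦ ⋁ f ⟧     G ρ = ∃ λ i → ⟦ f i ⟧ G ρ
⟦ ∀ᶠ φ ⟧    G ρ = ∀ a → ⟦ φ ⟧ G (extend a ρ)
⟦ ∃ᶠ φ ⟧    G ρ = ∃ λ a → ⟦ φ ⟧ G (extend a ρ)
⟦ ∀ⁿ k φ ⟧  G ρ = (e : Env G k) → ⟦ φ ⟧ G (e ⧺ ρ)
⟦ ∃ⁿ k φ ⟧  G ρ = Σ (Env G k) λ e → ⟦ φ ⟧ G (e ⧺ ρ)
⟦ ren σ φ ⟧ G ρ = ⟦ φ ⟧ G (ρ ∘ σ)

-- Index sets are nonempty because the language has no constants for truth and falsity.
all-of some-of : ∀ {n k} → (Fin (suc k) → Formula n) → Formula n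
all-of {k = zero}  f = f zero
all-of {k = suc k} f = f zero ∧' all-of (f ∘ suc)
some-of {k = zero}  f = f zero
some-of {k = suc k} f = f zero ∨' some-of (f ∘ suc)

∀-block ∃-block : ∀ k {n} → Formula (k + n) → Formula n
∀-block zero    φ = φ
∀-block (suc k) φ = ∀-block k (∀' φ)
∃-block zero    φ = φ
∃-block (suc k) φ = ∃-block k (∃' φ)

compile : ∀ {n} → Fm n → Formula n
compile (x == y)  = x ≐ y
compile (x ~[ true ] y)  = E x y
compile (x ~[ false ] y) = ¬' E x y
compile (¬ᶠ φ)    = ¬' compile φ
compile (φ ∧ᶠ ψ)  = compile φ ∧' compile ψ
compile (φ ∨ᶠ ψ)  = compile φ ∨' compile ψ
compile (φ ⇒ ψ)   = (¬' compile φ) ∨' compile ψ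
compile (⋀ f)     = all-of (compile ∘ f)
compile (⋁ f)     = some-of (compile ∘ f)
compile (∀ᶠ φ)    = ∀' compile φ
compile (∃ᶠ φ)    = ∃' compile φ
compile (∀ⁿ k φ)  = ∀-block k (compile φ)
compile (∃ⁿ k φ)  = ∃-block k (compile φ)
compile (ren σ φ) = rename σ (compile φ)

module _ {G : Graph} where
  Sat-all-of : ∀ {n k} {ρ : Env G n} (f : Fin (suc k) → Formula n) →
               Sat G ρ (all-of f) ⟺ (∀ i → Sat G ρ (f i))
  Sat-all-of {k = zero}  f = (λ { s zero → s }) , (λ s → s zero)
  Sat-all-of {k = suc k} f with Sat-all-of (f ∘ suc)
  ... | g , g′ = (λ { (s , t) zero → s ; (s , t) (suc i) → g t i }) , λ s → s zero , g′ (s ∘ suc)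

  Sat-some-of : ∀ {n k} {ρ : Env G n} (f : Fin (suc k) → Formula n) →
                Sat G ρ (some-of f) ⟺ (∃ λ i → Sat G ρ (f i))
  Sat-some-of {k = zero}  f = (λ s → zero , s) , (λ { (zero , s) → s })
  Sat-some-of {k = suc k} f with Sat-some-of (f ∘ suc)
  ... | g , g′ = (λ { (inj₁ s) → zero , s ; (inj₂ t) → let i , s = g t in suc i , s }) ,
                 (λ { (zero , s) → inj₁ s ; (suc i , s) → inj₂ (g′ (i , s)) })

  extend-⧺ : ∀ {k n} (e : Env G (suc k)) (ρ : Env G n) →
             extend (e zero) ((e ∘ suc) ⧺ ρ) ≗ e ⧺ ρ
  extend-⧺ e ρ zero = refl
  extend-⧺ {k} e ρ (suc i) with splitAt k i
  ... | inj₁ j = refl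
  ... | inj₂ j = refl

  Sat-∀-block : ∀ k {n} {ρ : Env G n} (φ : Formula (k + n)) →
                Sat G ρ (∀-block k φ) ⟺ (∀ e → Sat G (e ⧺ ρ) φ)
  Sat-∀-block zero    φ = (λ s e → s) , (λ s → s (λ ()))
  Sat-∀-block (suc k) {ρ = ρ} φ with Sat-∀-block k {ρ = ρ} (∀' φ)
  ... | g , g′ = (λ s e → Sat-cong {G = G} (extend-⧺ e ρ) φ (g s (e ∘ suc) (e zero))) ,
                 (λ s → g′ λ e a → Sat-cong {G = G} (sym ∘ extend-⧺ (extend a e) ρ) φ (s (extend a e)))

  Sat-∃-block : ∀ k {n} {ρ : Env G n} (φ : Formula (k + n)) →
                Sat G ρ (∃-block k φ) ⟺ (∃ λ e → Sat G (e ⧺ ρ) φ)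
  Sat-∃-block zero    φ = (λ s → (λ ()) , s) , proj₂
  Sat-∃-block (suc k) {ρ = ρ} φ with Sat-∃-block k {ρ = ρ} (∃' φ)
  ... | g , g′ = (λ s → let e , a , t = g s in
                   extend a e , Sat-cong {G = G} (extend-⧺ (extend a e) ρ) φ t) ,
                 (λ (e , s) → g′ (e ∘ suc , e zero , Sat-cong {G = G} (sym ∘ extend-⧺ e ρ) φ s))

  Sat-compile : ∀ {n} {ρ : Env G n} (φ : Fm n) → Sat G ρ (compile φ) ⟺ ⟦ φ ⟧ G ρ
  Sat-compile (x == y) = id , id
  Sat-compile (x ~[ true ] y)  = Equivalence.to T-≡ , Equivalence.from T-≡
  Sat-compile {ρ = ρ} (x ~[ false ] y) with adj G (ρ x) (ρ y)
  ... | true  = (λ ¬t → contradiction tt ¬t) , (λ ())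
  ... | false = (λ _ → refl) , (λ _ t → t)
  Sat-compile (¬ᶠ φ)   = (_∘ proj₂ (Sat-compile φ)) , (_∘ proj₁ (Sat-compile φ))
  Sat-compile {ρ = ρ} (φ ∧ᶠ ψ) with Sat-compile {ρ = ρ} φ | Sat-compile {ρ = ρ} ψ
  ... | f , f′ | g , g′ = (λ (a , b) → f a , g b) , (λ (a , b) → f′ a , g′ b)
  Sat-compile {ρ = ρ} (φ ∨ᶠ ψ) with Sat-compile {ρ = ρ} φ | Sat-compile {ρ = ρ} ψ
  ... | f , f′ | g , g′ = Sum.map f g , Sum.map f′ g′
  Sat-compile {ρ = ρ} (φ ⇒ ψ) with Sat-compile {ρ = ρ} φ | Sat-compile {ρ = ρ} ψ
  ... | f , f′ | g , g′ = (λ { (inj₁ ¬a) a → contradiction (f′ a) ¬a ; (inj₂ b) _ → g b }) , back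
    where
    back : (⟦ φ ⟧ G ρ → ⟦ ψ ⟧ G ρ) → _
    back h with Sat? G ρ (compile φ)
    ... | yes a = inj₂ (g′ (h (f a)))
    ... | no ¬a = inj₁ ¬a
  Sat-compile {ρ = ρ} (⋀ f) with Sat-all-of {ρ = ρ} (compile ∘ f)
  ... | g , g′ = (λ s i → proj₁ (Sat-compile (f i)) (g s i)) ,
                 (λ s → g′ λ i → proj₂ (Sat-compile (f i)) (s i))
  Sat-compile {ρ = ρ} (⋁ f) with Sat-some-of {ρ = ρ} (compile ∘ f)
  ... | g , g′ = (λ s → let i , t = g s in i , proj₁ (Sat-compile (f i)) t) ,
                 (λ (i , s) → g′ (i , proj₂ (Sat-compile (f i)) s))
  Sat-compile (∀ᶠ φ) = (λ s a → proj₁ (Sat-compile φ) (s a)) , (λ s a → proj₂ (Sat-compile φ) (s a))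
  Sat-compile (∃ᶠ φ) = (λ (a , s) → a , proj₁ (Sat-compile φ) s) ,
                       (λ (a , s) → a , proj₂ (Sat-compile φ) s)
  Sat-compile {ρ = ρ} (∀ⁿ k φ) with Sat-∀-block k {ρ = ρ} (compile φ)
  ... | g , g′ = (λ s e → proj₁ (Sat-compile φ) (g s e)) ,
                 (λ s → g′ λ e → proj₂ (Sat-compile φ) (s e))
  Sat-compile {ρ = ρ} (∃ⁿ k φ) with Sat-∃-block k {ρ = ρ} (compile φ)
  ... | g , g′ = (λ s → let e , t = g s in e , proj₁ (Sat-compile φ) t) ,
                 (λ (e , s) → g′ (e , proj₂ (Sat-compile φ) s))
  Sat-compile {ρ = ρ} (ren σ φ) with Sat-rename {σ = σ} {ρ = ρ} (λ _ → refl) (compile φ)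
  ... | g , g′ = proj₁ (Sat-compile φ) ∘ g , g′ ∘ proj₂ (Sat-compile φ)

⟦⟧-cong : ∀ G {n} {ρ σ : Env G n} → ρ ≗ σ → (φ : Fm n) → ⟦ φ ⟧ G ρ → ⟦ φ ⟧ G σ
⟦⟧-cong G q φ s = proj₁ (Sat-compile φ) (Sat-cong {G = G} q (compile φ) (proj₂ (Sat-compile φ) s))

⟦⟧? : ∀ G {n} (φ : Fm n) (ρ : Env G n) → Dec (⟦ φ ⟧ G ρ)
⟦⟧? G φ ρ = map′ (proj₁ (Sat-compile φ)) (proj₂ (Sat-compile φ)) (Sat? G ρ (compile φ))

⟦ren⟧-⧺ : ∀ G {k n} (φ : Fm k) (e : Env G k) (ρ : Env G n) → ⟦ ren (_↑ˡ n) φ ⟧ G (e ⧺ ρ) ⟺ ⟦ φ ⟧ G e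
⟦ren⟧-⧺ G φ e ρ = ⟦⟧-cong G (lookup-++ˡ e ρ) φ , ⟦⟧-cong G (sym ∘ lookup-++ˡ e ρ) φ

-- Evaluation of programs and the diagonal sentence

⇓-deterministic  : ∀ {k} {f : PR k} {xs y z} → f ⟨ xs ⟩⇓ y → f ⟨ xs ⟩⇓ z → y ≡ z
⇓*-deterministic : ∀ {k m} {fs : Vec (PR k) m} {xs ys zs} → fs ⟨ xs ⟩⇓* ys → fs ⟨ xs ⟩⇓* zs → ys ≡ zs
⇓-deterministic ev-zer ev-zer = refl
⇓-deterministic ev-succ ev-succ = refl
⇓-deterministic ev-proj ev-proj = refl
⇓-deterministic (ev-comp d e) (ev-comp d′ e′) with refl ← ⇓*-deterministic d d′ = ⇓-deterministic e e′
⇓-deterministic (ev-prec0 d) (ev-prec0 d′) = ⇓-deterministic d d′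
⇓-deterministic (ev-precS d e) (ev-precS d′ e′) with refl ← ⇓-deterministic d d′ = ⇓-deterministic e e′
⇓-deterministic (ev-mu {n = m} d below) (ev-mu {n = n} d′ below′) with ℕ.<-cmp m n
... | tri≈ _ m≡n _ = m≡n
... | tri< m<n _ _ with () ← ⇓-deterministic d (proj₂ (below′ m m<n))
... | tri> _ _ n<m with () ← ⇓-deterministic d′ (proj₂ (below n n<m))
⇓*-deterministic ev-[] ev-[] = refl
⇓*-deterministic (ev-∷ d ds) (ev-∷ e es) = cong₂ _∷_ (⇓-deterministic d e) (⇓*-deterministic ds es)

-- Sealed versions of pair and code: unfolding tri on numerals never terminates in practice.
abstract
  infixr 4 _⊗_
  _⊗_ : ℕ → ℕ → ℕ
  _⊗_ = pair

  ⌜_⌝ : ∀ {n} → Formula n → ℕ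
  ⌜_⌝ = code

  ⌜⌝≡code : ∀ {n} (φ : Formula n) → ⌜ φ ⌝ ≡ code φ
  ⌜⌝≡code φ = refl

  ⊗≡pair : ∀ x y → (x ⊗ y) ≡ pair x y
  ⊗≡pair x y = refl

  ⌜≐⌝ : ∀ {n} (x y : Fin n) → ⌜ x ≐ y ⌝ ≡ (0 ⊗ toℕ x ⊗ toℕ y)
  ⌜≐⌝ x y = refl

  ⌜E⌝ : ∀ {n} (x y : Fin n) → ⌜ E x y ⌝ ≡ (1 ⊗ toℕ x ⊗ toℕ y)
  ⌜E⌝ x y = refl

  ⌜¬⌝ : ∀ {n} (φ : Formula n) → ⌜ ¬' φ ⌝ ≡ (2 ⊗ ⌜ φ ⌝)
  ⌜¬⌝ φ = refl

  ⌜∧⌝ : ∀ {n} (φ ψ : Formula n) → ⌜ φ ∧' ψ ⌝ ≡ (3 ⊗ ⌜ φ ⌝ ⊗ ⌜ ψ ⌝)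
  ⌜∧⌝ φ ψ = refl

  ⌜∨⌝ : ∀ {n} (φ ψ : Formula n) → ⌜ φ ∨' ψ ⌝ ≡ (4 ⊗ ⌜ φ ⌝ ⊗ ⌜ ψ ⌝)
  ⌜∨⌝ φ ψ = refl

  ⌜∀⌝ : ∀ {n} (φ : Formula (suc n)) → ⌜ ∀' φ ⌝ ≡ (5 ⊗ ⌜ φ ⌝)
  ⌜∀⌝ φ = refl

  ⌜∃⌝ : ∀ {n} (φ : Formula (suc n)) → ⌜ ∃' φ ⌝ ≡ (6 ⊗ ⌜ φ ⌝)
  ⌜∃⌝ φ = refl

PreservesIndex : ∀ {m n} → (Fin m → Fin n) → Set
PreservesIndex σ = ∀ i → toℕ (σ i) ≡ toℕ i

lift-preservesIndex : ∀ {m n} {σ : Fin m → Fin n} → PreservesIndex σ → PreservesIndex (lift σ)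
lift-preservesIndex q zero    = refl
lift-preservesIndex q (suc i) = cong suc (q i)

-- A code records a variable only by the number `toℕ` of its index and forgets the scope. Numerals
-- thus have the same code in every scope, which makes their codes computable by a plain recursion.
code-rename : ∀ {m n} {σ : Fin m → Fin n} → PreservesIndex σ →
              (φ : Formula m) → ⌜ rename σ φ ⌝ ≡ ⌜ φ ⌝
code-rename q (x ≐ y)  = trans (⌜≐⌝ _ _) (trans (cong (0 ⊗_) (cong₂ _⊗_ (q x) (q y))) (sym (⌜≐⌝ x y)))
code-rename q (E x y)  = trans (⌜E⌝ _ _) (trans (cong (1 ⊗_) (cong₂ _⊗_ (q x) (q y))) (sym (⌜E⌝ x y)))
code-rename q (¬' φ)   = trans (⌜¬⌝ _) (trans (cong (2 ⊗_) (code-rename q φ)) (sym (⌜¬⌝ φ)))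
code-rename q (φ ∧' ψ) = trans (⌜∧⌝ _ _)
  (trans (cong (3 ⊗_) (cong₂ _⊗_ (code-rename q φ) (code-rename q ψ))) (sym (⌜∧⌝ φ ψ)))
code-rename q (φ ∨' ψ) = trans (⌜∨⌝ _ _)
  (trans (cong (4 ⊗_) (cong₂ _⊗_ (code-rename q φ) (code-rename q ψ))) (sym (⌜∨⌝ φ ψ)))
code-rename q (∀' φ)   = trans (⌜∀⌝ _)
  (trans (cong (5 ⊗_) (code-rename (lift-preservesIndex q) φ)) (sym (⌜∀⌝ φ)))
code-rename q (∃' φ)   = trans (⌜∃⌝ _)
  (trans (cong (6 ⊗_) (code-rename (lift-preservesIndex q) φ)) (sym (⌜∃⌝ φ)))

Computes₁ : PR 1 → (ℕ → ℕ) → Set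
Computes₁ f F = ∀ x → f ⟨ x ∷ [] ⟩⇓ F x

Computes₂ : PR 2 → (ℕ → ℕ → ℕ) → Set
Computes₂ f F = ∀ x y → f ⟨ x ∷ y ∷ [] ⟩⇓ F x y

constP : ∀ {k} → ℕ → PR k
constP zero    = zer
constP (suc n) = comp succ (constP n ∷ [])

constP-⇓ : ∀ {k} n {xs : Vec ℕ k} → constP n ⟨ xs ⟩⇓ n
constP-⇓ zero    = ev-zer
constP-⇓ (suc n) = ev-comp (ev-∷ (constP-⇓ n) ev-[]) ev-succ

addP : PR 2
addP = prec (proj zero) (comp succ (proj (suc zero) ∷ []))

addP-⇓ : Computes₂ addP _+_
addP-⇓ zero    y = ev-prec0 ev-proj
addP-⇓ (suc x) y = ev-precS (addP-⇓ x y) (ev-comp (ev-∷ ev-proj ev-[]) ev-succ)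

triP : PR 1
triP = prec zer (comp addP (comp succ (proj zero ∷ []) ∷ proj (suc zero) ∷ []))

triP-⇓ : Computes₁ triP tri
triP-⇓ zero    = ev-prec0 ev-zer
triP-⇓ (suc n) = ev-precS (triP-⇓ n)
  (ev-comp (ev-∷ (ev-comp (ev-∷ ev-proj ev-[]) ev-succ) (ev-∷ ev-proj ev-[])) (addP-⇓ (suc n) (tri n)))

pairP : PR 2
pairP = comp addP (comp triP (addP ∷ []) ∷ proj zero ∷ [])

pairP-⇓ : Computes₂ pairP pair
pairP-⇓ x y = ev-comp
  (ev-∷ (ev-comp (ev-∷ (addP-⇓ x y) ev-[]) (triP-⇓ (x + y))) (ev-∷ ev-proj ev-[]))
  (addP-⇓ (tri (x + y)) x)

⟪_,_⟫ : ∀ {k} → PR k → PR k → PR k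
⟪ f , g ⟫ = comp pairP (f ∷ g ∷ [])

⟪⟫-⇓ : ∀ {k} {f g : PR k} {xs y z} → f ⟨ xs ⟩⇓ y → g ⟨ xs ⟩⇓ z → ⟪ f , g ⟫ ⟨ xs ⟩⇓ (y ⊗ z)
⟪⟫-⇓ {f = f} {g} {xs} {y} {z} d e = subst (⟪ f , g ⟫ ⟨ xs ⟩⇓_) (sym (⊗≡pair y z))
  (ev-comp (ev-∷ d (ev-∷ e ev-[])) (pairP-⇓ y z))

module Numerals (Z : Formula 1) (S : Formula 2) where

  first : ∀ {m k} → Fin (suc m) → Fin (suc (m + k))
  first {m}     zero    = zero
  first {suc m} (suc i) = suc (first i)

  toℕ-first : ∀ {m k} (i : Fin (suc m)) → toℕ (first {m} {k} i) ≡ toℕ i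
  toℕ-first {m}     zero    = refl
  toℕ-first {suc m} (suc i) = cong suc (toℕ-first i)

  -- S (y , x) says that x is the successor of y.
  numeral : ∀ {k} → ℕ → Formula (suc k)
  numeral zero    = rename first Z
  numeral (suc a) = ∃' (rename first S ∧' numeral a)

  numeral-code : ℕ → ℕ
  numeral-code zero    = ⌜ Z ⌝
  numeral-code (suc a) = 6 ⊗ 3 ⊗ ⌜ S ⌝ ⊗ numeral-code a

  code-numeral : ∀ {k} a → ⌜ numeral {k} a ⌝ ≡ numeral-code a
  code-numeral zero    = code-rename toℕ-first Z
  code-numeral (suc a) = trans (⌜∃⌝ _) (cong (6 ⊗_) (trans (⌜∧⌝ _ _)
    (cong (3 ⊗_) (cong₂ _⊗_ (code-rename toℕ-first S) (code-numeral a)))))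

  numeral-codeP : PR 1
  numeral-codeP = prec (constP ⌜ Z ⌝)
    ⟪ constP 6 , ⟪ constP 3 , ⟪ constP ⌜ S ⌝ , proj (suc zero) ⟫ ⟫ ⟫

  numeral-codeP-⇓ : Computes₁ numeral-codeP numeral-code
  numeral-codeP-⇓ zero    = ev-prec0 (constP-⇓ ⌜ Z ⌝)
  numeral-codeP-⇓ (suc a) = ev-precS (numeral-codeP-⇓ a)
    (⟪⟫-⇓ (constP-⇓ 6) (⟪⟫-⇓ (constP-⇓ 3) (⟪⟫-⇓ (constP-⇓ ⌜ S ⌝) ev-proj)))

  module Diagonal (U : Sentence) (c : PR 1) where

    -- Instead of substituting a number into `θ`, the sentence relativises `θ` to the vertices
    -- satisfying the numeral. Its code is then a fixed pairing expression in the codes of `θ` and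
    -- of the numeral, so no substitution on codes has to be programmed.
    instance-of : Formula 1 → ℕ → Sentence
    instance-of θ a = U ∧' (∀' ((¬' numeral a) ∨' θ))

    instance-codeP : PR 1
    instance-codeP = ⟪ constP 3 , ⟪ constP ⌜ U ⌝ , ⟪ constP 5 , ⟪ constP 4 ,
      ⟪ ⟪ constP 2 , numeral-codeP ⟫ , proj zero ⟫ ⟫ ⟫ ⟫ ⟫

    -- Applied to the code of θ, it runs c on the code of the sentence saying "θ holds of
    -- the code of θ".
    self-apply : PR 1
    self-apply = comp c (instance-codeP ∷ [])

    module _ (θ : Formula 1) where

      fixed-point : Sentence
      fixed-point = instance-of θ ⌜ θ ⌝

      ⌜fixed-point⌝ : ⌜ fixed-point ⌝ ≡ (3 ⊗ ⌜ U ⌝ ⊗ 5 ⊗ 4 ⊗ (2 ⊗ numeral-code ⌜ θ ⌝) ⊗ ⌜ θ ⌝)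
      ⌜fixed-point⌝ = trans (⌜∧⌝ _ _) (cong (λ n → 3 ⊗ ⌜ U ⌝ ⊗ n)
        (trans (⌜∀⌝ _) (cong (5 ⊗_) (trans (⌜∨⌝ _ _) (cong (λ n → 4 ⊗ n ⊗ ⌜ θ ⌝)
          (trans (⌜¬⌝ _) (cong (2 ⊗_) (code-numeral ⌜ θ ⌝))))))))

      instance-codeP-⇓ : instance-codeP ⟨ ⌜ θ ⌝ ∷ [] ⟩⇓ code fixed-point
      instance-codeP-⇓ = subst (instance-codeP ⟨ ⌜ θ ⌝ ∷ [] ⟩⇓_)
        (trans (sym ⌜fixed-point⌝) (⌜⌝≡code fixed-point))
        (⟪⟫-⇓ (constP-⇓ 3) (⟪⟫-⇓ (constP-⇓ ⌜ U ⌝) (⟪⟫-⇓ (constP-⇓ 5) (⟪⟫-⇓ (constP-⇓ 4)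
          (⟪⟫-⇓ (⟪⟫-⇓ (constP-⇓ 2) (numeral-codeP-⇓ ⌜ θ ⌝)) ev-proj)))))

      self-apply-⇓ : ∀ {y} → c ⟨ code fixed-point ∷ [] ⟩⇓ y → self-apply ⟨ ⌜ θ ⌝ ∷ [] ⟩⇓ y
      self-apply-⇓ d = ev-comp (ev-∷ instance-codeP-⇓ ev-[]) d

      self-apply-⇓⁻ : ∀ {y} → self-apply ⟨ ⌜ θ ⌝ ∷ [] ⟩⇓ y → c ⟨ code fixed-point ∷ [] ⟩⇓ y
      self-apply-⇓⁻ (ev-comp (ev-∷ d ev-[]) e) =
        subst (λ n → c ⟨ n ∷ [] ⟩⇓ _) (⇓-deterministic d instance-codeP-⇓) e

-- Counting

count : ∀ {n} → (Fin n → Bool) → ℕ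
count {zero}  p = 0
count {suc n} p with p zero
... | true  = suc (count (p ∘ suc))
... | false = count (p ∘ suc)

count-none : ∀ {n} (p : Fin n → Bool) → (∀ i → p i ≡ false) → count p ≡ 0
count-none {zero}  p h = refl
count-none {suc n} p h rewrite h zero = count-none (p ∘ suc) (h ∘ suc)

count-cong : ∀ {n} {p q : Fin n → Bool} → p ≗ q → count p ≡ count q
count-cong {zero}  h = refl
count-cong {suc n} {p} {q} h with p zero | q zero | h zero
... | true  | true  | _ = cong suc (count-cong (h ∘ suc))
... | false | false | _ = count-cong (h ∘ suc)

count-insert : ∀ {n} {p q : Fin n → Bool} j → p j ≡ false → q j ≡ true →
               (∀ i → i ≢ j → p i ≡ q i) → count q ≡ suc (count p)
count-insert {p = p} {q} zero pj qj h rewrite pj | qj =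
  cong suc (sym (count-cong λ i → h (suc i) λ ()))
count-insert {p = p} {q} (suc j) pj qj h with p zero | q zero | h zero (λ ())
... | true  | true  | _ = cong suc (count-insert j pj qj λ i i≢j → h (suc i) (i≢j ∘ Fin.suc-injective))
... | false | false | _ = count-insert j pj qj λ i i≢j → h (suc i) (i≢j ∘ Fin.suc-injective)

count-mono : ∀ {n} {p q : Fin n → Bool} → (∀ i → p i ≡ true → q i ≡ true) → count p ≤ count q
count-mono {zero}  h = z≤n
count-mono {suc n} {p} {q} h with p zero | q zero | h zero
... | true  | true  | _  = s≤s (count-mono (h ∘ suc))
... | true  | false | h₀ with () ← h₀ refl
... | false | true  | _  = ℕ.m≤n⇒m≤1+n (count-mono (h ∘ suc))
... | false | false | _  = count-mono (h ∘ suc)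

count-strict : ∀ {n} {p q : Fin n → Bool} → (∀ i → p i ≡ true → q i ≡ true) →
               ∀ j → p j ≡ false → q j ≡ true → count p < count q
count-strict {p = p} {q} h zero pj qj rewrite pj | qj = s≤s (count-mono (h ∘ suc))
count-strict {suc n} {p} {q} h (suc j) pj qj with p zero | q zero | h zero
... | true  | true  | _  = s≤s (count-strict (h ∘ suc) j pj qj)
... | true  | false | h₀ with () ← h₀ refl
... | false | true  | _  = ℕ.m≤n⇒m≤1+n (count-strict (h ∘ suc) j pj qj)
... | false | false | _  = count-strict (h ∘ suc) j pj qj

-- Vertex types

Type : Set
Type = Fin 9

row : Fin 4 → Type
row r = r ↑ˡ 5

single : Fin 4 → Type
single s = 5 ↑ʳ s

tableT : Fin 3 → Type
tableT κ = row (κ ↑ˡ 1)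

-- Numbers other than the two ends form a fourth row: they are marked along `up` in the same way as
-- the three table rows.
numT upT upLo upHi numLo numHi : Type
numT  = row (3 ↑ʳ zero)
upT   = 4 ↑ʳ zero
upLo  = single zero
upHi  = single (suc zero)
numLo = single (suc (suc zero))
numHi = single (suc (suc (suc zero)))

-- The 14 is 8 + 1 + 5. Eight clique vertices tell the nine types apart; a ninth has no neighbour
-- outside the clique and owns a colour; five more match the colours of the other vertices in the
-- constructed graphs, one for the tables and two for each of the two paths.
K : ℕ
K = 14 + 9

abstract
  gv : Fin 14 → Fin K
  gv i = i ↑ˡ 9

  hv : Type → Fin K
  hv t = 14 ↑ʳ t

  assemble : ∀ {A : Set} → (Fin 14 → A) → (Type → A) → Fin K → A
  assemble g h = g ⧺ h

  assemble-gv : ∀ {A : Set} (g : Fin 14 → A) (h : Type → A) → assemble g h ∘ gv ≗ g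
  assemble-gv = lookup-++ˡ

  assemble-hv : ∀ {A : Set} (g : Fin 14 → A) (h : Type → A) → assemble g h ∘ hv ≗ h
  assemble-hv = lookup-++ʳ

-- The guard is a 14-clique together with one vertex of each type, where a vertex of type t is
-- adjacent to exactly the first t vertices of the clique.
hasType : ∀ {n} → (Fin K → Fin n) → Type → Fin n → Fm n
hasType σ t x = ⋀ λ i → (¬ᶠ (x == σ (gv i))) ∧ᶠ x ~[ toℕ i <ᵇ toℕ t ] σ (gv i)

guard : Fm K
guard = (⋀ λ i → ⋀ λ j → gv i ~[ not ⌊ i Fin.≟ j ⌋ ] gv j) ∧ᶠ (⋀ λ t → hasType id t (hv t))

abstract
  -- Quantifying the guard away turns the type into a property of a single vertex, so that the
  -- formulas for computations need not carry a guard as parameter.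
  typed : Type → Fm 1
  typed t = ∃ⁿ K (ren (_↑ˡ 1) guard ∧ᶠ hasType (_↑ˡ 1) t (K ↑ʳ zero))

module _ (G : Graph) where
  Guard : Env G K → Set
  Guard e = ⟦ guard ⟧ G e

  HasType : Env G K → Type → V G → Set
  HasType e t v = ∀ i → v ≢ e (gv i) × adj G v (e (gv i)) ≡ (toℕ i <ᵇ toℕ t)

  Typed : Type → V G → Set
  Typed t v = ⟦ typed t ⟧ G (λ _ → v)

  HasType-cong : ∀ {e e′ t v} → e ≗ e′ → HasType e t v → HasType e′ t v
  HasType-cong {v = v} q h i = subst (λ w → v ≢ w × adj G v w ≡ _) (q (gv i)) (h i)

  abstract
    Typed-intro : ∀ e t v → Guard e → HasType e t v → Typed t v
    Typed-intro e t v g h = e , proj₂ (⟦ren⟧-⧺ G guard e (λ _ → v)) g ,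
      HasType-cong {e} {_} {t} {v} (sym ∘ lookup-++ˡ e (λ _ → v)) h

    Typed-elim : ∀ t v → Typed t v → ∃ λ e → Guard e × HasType e t v
    Typed-elim t v (e , g , h) = e , proj₁ (⟦ren⟧-⧺ G guard e (λ _ → v)) g ,
      HasType-cong {_} {e} {t} {v} (lookup-++ˡ e (λ _ → v)) h

  Typed? : ∀ t v → Dec (Typed t v)
  Typed? t v = ⟦⟧? G (typed t) (λ _ → v)

-- Universal and completeness conditions

record Class : Set where
  constructor class
  field
    {pred}  : ℕ
    members : Fin (suc pred) → Type

inClass : ∀ {n} → Class → (Fin K → Fin n) → Fin n → Fm n
inClass (class c) σ x = ⋁ λ i → hasType σ (c i) x

InClass : (G : Graph) → Class → Env G K → V G → Set
InClass G (class c) e v = ∃ λ i → HasType G e (c i) v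

-- `member` is the type to be kept from growing, `flips` the class of all vertices that occupy edges
-- of the chain. They differ for `upR`: `upLo` and `upHi` occupy the two outermost edges of the
-- number chain, but need no exclusion, being unique in their types.
record Rigid : Set where
  field
    member     : Type
    flips      : Class
    chain      : Class
    start end  : Type
    member-flips : ∃ λ i → Class.members flips i ≡ member
    start-chain  : ∃ λ i → Class.members chain i ≡ start

upClass numClass : Class
upClass  = class (lookup (upT ∷ upLo ∷ upHi ∷ []))
numClass = class (lookup (numT ∷ numLo ∷ numHi ∷ []))

rowR : Fin 4 → Rigid
rowR r = record
  { member = row r ; flips = class {0} (λ _ → row r) ; chain = upClass ; start = upLo ; end = upHi
  ; member-flips = zero , refl ; start-chain = suc zero , refl }

-- The chain runs from `numHi` down to `numLo` because an `up` vertex is meant to see the numbers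
-- above it, whereas a row vertex sees the `up` vertices up to its own position.
upR : Rigid
upR = record
  { member = upT ; flips = upClass ; chain = numClass ; start = numHi ; end = numLo
  ; member-flips = zero , refl ; start-chain = suc (suc zero) , refl }

-- At most one vertex of the class flips along each edge of the chain, that is, is adjacent to
-- the first end of the edge but not to the second one; chained says that some vertex does.
rigid : Rigid → Fm K
rigid R =
  (∀ᶠ (hasType suc member zero ⇒ zero ~[ true ] suc (hv start) ∧ᶠ zero ~[ false ] suc (hv end))) ∧ᶠ
  (∀ᶠ ∀ᶠ ∀ᶠ ∀ᶠ (inClass chain σ₄ a ⇒ inClass chain σ₄ b ⇒ a ~[ true ] b ⇒
     inClass flips σ₄ v ⇒ inClass flips σ₄ w ⇒
     v ~[ true ] a ⇒ v ~[ false ] b ⇒ w ~[ true ] a ⇒ w ~[ false ] b ⇒ v == w))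
  where
  open Rigid R
  σ₄ : Fin K → Fin (4 + K)
  σ₄ = 4 ↑ʳ_
  a b v w : Fin (4 + K)
  a = suc (suc (suc zero))
  b = suc (suc zero)
  v = suc zero
  w = zero

chained : Rigid → Fm K
chained R =
  ∀ᶠ (inClass chain suc zero ⇒ ¬ᶠ (zero == suc (hv end)) ⇒
    (∃ᶠ ∃ᶠ (inClass chain (3 ↑ʳ_) (suc zero) ∧ᶠ suc (suc zero) ~[ true ] suc zero ∧ᶠ
      inClass flips (3 ↑ʳ_) zero ∧ᶠ zero ~[ true ] suc (suc zero) ∧ᶠ zero ~[ false ] suc zero ∧ᶠ
      -- First-order conditions cannot force the chain to be a path, so a walk along it might cycle.
      -- With this inclusion the `flips` neighbours shrink strictly at each step, and in a finite
      -- graph the walk must reach the end.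
      (∀ᶠ (inClass flips (4 ↑ʳ_) zero ⇒ zero ~[ true ] suc (suc zero) ⇒
           zero ~[ true ] suc (suc (suc zero)))))))
  where
  open Rigid R

univ : Fm K
univ =
  (∀ᶠ ((⋁ λ i → zero == suc (gv i)) ∨ᶠ (⋁ λ t → hasType suc t zero))) ∧ᶠ
  (⋀ λ s → ∀ᶠ (hasType suc (single s) zero ⇒ zero == suc (hv (single s)))) ∧ᶠ
  (⋀ λ r → rigid (rowR r)) ∧ᶠ rigid upR

complete : Fm K
complete = (⋀ λ r → chained (rowR r)) ∧ᶠ chained upR

abstract
  univᶜ core : Fm 0
  univᶜ = ∀ⁿ K (ren (_↑ˡ 0) (guard ⇒ univ))
  core  = ∃ⁿ K (ren (_↑ˡ 0) (guard ∧ᶠ complete))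

  univᶜ-universal : T (isUniversal true (compile univᶜ))
  univᶜ-universal = _

  univᶜ-elim : ∀ G → ⟦ univᶜ ⟧ G empty-env → ∀ e → Guard G e → ⟦ univ ⟧ G e
  univᶜ-elim G s e = proj₁ (⟦ren⟧-⧺ G (guard ⇒ univ) e empty-env) (s e)

  univᶜ-intro : ∀ G → (∀ e → Guard G e → ⟦ univ ⟧ G e) → ⟦ univᶜ ⟧ G empty-env
  univᶜ-intro G s e = proj₂ (⟦ren⟧-⧺ G (guard ⇒ univ) e empty-env) (s e)

  core-elim : ∀ G → ⟦ core ⟧ G empty-env → ∃ λ e → Guard G e × ⟦ complete ⟧ G e
  core-elim G (e , s) = e , proj₁ (⟦ren⟧-⧺ G (guard ∧ᶠ complete) e empty-env) s

  core-intro : ∀ G e → Guard G e → ⟦ complete ⟧ G e → ⟦ core ⟧ G empty-env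
  core-intro G e g c = e , proj₂ (⟦ren⟧-⧺ G (guard ∧ᶠ complete) e empty-env) (g , c)

data RigidOrSingle : Type → Set where
  isRigid  : ∀ R → ((∀ G e → ⟦ univ ⟧ G e → ⟦ rigid R ⟧ G e) × (∀ G e → ⟦ complete ⟧ G e → ⟦ chained R ⟧ G e)) →
             RigidOrSingle (Rigid.member R)
  isSingle : ∀ s → RigidOrSingle (single s)

rigidRow : ∀ r → RigidOrSingle (row r)
rigidRow r = isRigid (rowR r) ((λ _ _ u → proj₁ (proj₂ (proj₂ u)) r) , (λ _ _ c → proj₁ c r))

rigidOrSingle : ∀ t → RigidOrSingle t
rigidOrSingle zero                   = rigidRow zero
rigidOrSingle (suc zero)             = rigidRow (suc zero)
rigidOrSingle (suc (suc zero))       = rigidRow (suc (suc zero))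
rigidOrSingle (suc (suc (suc zero))) = rigidRow (suc (suc (suc zero)))
rigidOrSingle (suc (suc (suc (suc zero)))) =
  isRigid upR ((λ _ _ u → proj₂ (proj₂ (proj₂ u))) , (λ _ _ c → proj₂ c))
rigidOrSingle (suc (suc (suc (suc (suc s))))) = isSingle s

HasType? : ∀ G e t v → Dec (HasType G e t v)
HasType? G e t v = Fin.all? λ i → ¬? (v Fin.≟ e (gv i)) ×-dec (adj G v (e (gv i)) Bool.≟ _)

InClass? : ∀ G c e v → Dec (InClass G c e v)
InClass? G (class c) e v = Fin.any? λ i → HasType? G e (c i) v

module Rigidity {A B : Graph} (f : V B → V A) (inj : ∀ {x y} → f x ≡ f y → x ≡ y)
                (hom : ∀ x y → adj B x y ≡ adj A (f x) (f y))
                (e : Env B K) (g : Guard B e) (u : ⟦ univ ⟧ A (f ∘ e)) (c : ⟦ complete ⟧ B e) where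

  HasType-emb : ∀ {t v} → HasType B e t v → HasType A (f ∘ e) t (f v)
  HasType-emb {v = v} h i = (λ p → proj₁ (h i) (inj p)) , trans (sym (hom v (e (gv i)))) (proj₂ (h i))

  InClass-emb : ∀ {c v} → InClass B c e v → InClass A c (f ∘ e) (f v)
  InClass-emb {class members} {v} (i , h) = i , HasType-emb {members i} {v} h

  -- A vertex outside B would have to flip along an edge of the chain of B that is already
  -- flipped by a vertex of B.
  module _ (R : Rigid) (ri : ⟦ rigid R ⟧ A (f ∘ e)) (ch : ⟦ chained R ⟧ B e) where
    open Rigid R

    flippers : V B → V B → Bool
    flippers a w = ⌊ InClass? B flips e w ⌋ ∧ adj B w a

    flippers-true : ∀ {a w} → InClass B flips e w → adj B w a ≡ true → flippers a w ≡ true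
    flippers-true {a} {w} h p with InClass? B flips e w
    ... | yes _ = p
    ... | no ¬h = contradiction h ¬h

    flippers-false : ∀ {a w} → adj B w a ≡ false → flippers a w ≡ false
    flippers-false {a} {w} p with InClass? B flips e w
    ... | yes _ = p
    ... | no ¬h = refl

    flippers-elim : ∀ {a w} → flippers a w ≡ true → InClass B flips e w × adj B w a ≡ true
    flippers-elim {a} {w} p with InClass? B flips e w
    ... | yes h = h , p
    flippers-elim {a} {w} () | no ¬h

    member⇒flips : ∀ {v} → HasType A (f ∘ e) member v → InClass A flips (f ∘ e) v
    member⇒flips {v} h = let i , q = member-flips in i , subst (λ t → HasType A (f ∘ e) t v) (sym q) h

    descend : ∀ {v} → HasType A (f ∘ e) member v → (∀ u → f u ≢ v) →
              ∀ a → InClass B chain e a → Acc _<_ (count (flippers a)) →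
              adj A v (f a) ≡ true → ⊥
    descend {v} h v∉B a a∈ (acc rec) va = at-end? (a Fin.≟ e (hv end))
      where
      next : ∀ b w → InClass B chain e b → adj B a b ≡ true →
             InClass B flips e w → adj B w a ≡ true → adj B w b ≡ false →
             (∀ x → InClass B flips e x → adj B x b ≡ true → adj B x a ≡ true) →
             ∀ β → adj A v (f b) ≡ β → ⊥
      next b w b∈ ab w∈ wa wb mono true vb = descend h v∉B b b∈
        (rec (count-strict (λ x p → let x∈ , xb = flippers-elim p in flippers-true x∈ (mono x x∈ xb))
               w (flippers-false wb) (flippers-true w∈ wa))) vb
      next b w b∈ ab w∈ wa wb mono false vb = v∉B w (proj₂ ri (f a) (f b) (f w) v
        (InClass-emb {chain} {a} a∈) (InClass-emb {chain} {b} b∈) (trans (sym (hom a b)) ab)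
        (InClass-emb {flips} {w} w∈) (member⇒flips {v} h)
        (trans (sym (hom w a)) wa) (trans (sym (hom w b)) wb) va vb)
      at-end? : Dec (a ≡ e (hv end)) → ⊥
      at-end? (yes a≡end) = contradiction
        (trans (sym va) (subst (λ x → adj A v (f x) ≡ false) (sym a≡end) (proj₂ (proj₁ ri v h)))) λ ()
      at-end? (no a≢end) =
        let b , w , b∈ , ab , w∈ , wa , wb , mono = ch a a∈ a≢end
        in next b w b∈ ab w∈ wa wb mono _ refl

    no-new : ∀ {v} → HasType A (f ∘ e) member v → (∀ u → f u ≢ v) → ⊥
    no-new {v} h v∉B = descend h v∉B (e (hv start))
      (let i , q = start-chain in i , subst (λ t → HasType B e t (e (hv start))) (sym q) (proj₂ g start))
      (<-wellFounded _) (proj₁ (proj₁ ri v h))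

  no-new-type : ∀ {t} → RigidOrSingle t → ∀ {v} → HasType A (f ∘ e) t v → (∀ u → f u ≢ v) → ⊥
  no-new-type (isRigid R (ru , rc)) h v∉B = no-new R (ru A (f ∘ e) u) (rc B e c) h v∉B
  no-new-type (isSingle s) {v} h v∉B = v∉B _ (sym (proj₁ (proj₂ u) s v h))

  surjects : Surjects f
  surjects v with Fin.any? (λ x → f x Fin.≟ v)
  ... | yes p = p
  ... | no ¬p with proj₁ u v
  ...   | inj₁ (i , v≡)  = _ , sym v≡
  ...   | inj₂ (t , h)   = ⊥-elim (no-new-type (rigidOrSingle t) h λ x p → ¬p (x , p))

Guard-emb : ∀ {A B} ((f , _) : B ≤ind A) {e} → Guard B e → Guard A (f ∘ e)
Guard-emb (f , inj , hom) {e} (cl , ty) =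
  (λ i j → trans (sym (hom _ _)) (cl i j)) ,
  (λ t i → (λ p → proj₁ (ty t i) (inj p)) , trans (sym (hom _ _)) (proj₂ (ty t i)))

-- The guard of `B` is also a guard of `A`, so the universal conditions on `A` can be read relative
-- to the very vertices that name the complete structure of `B`.
core-maximal : ∀ {A B} (emb : B ≤ind A) → ⟦ univᶜ ⟧ A empty-env → ⟦ core ⟧ B empty-env → Surjects (proj₁ emb)
core-maximal {A} {B} emb@(f , inj , hom) uA cB =
  let e , g , c = core-elim B cB
  in Rigidity.surjects {A} {B} f inj hom e g (univᶜ-elim A uA (f ∘ e) (Guard-emb {A} {B} emb {e} g)) c

-- Computations inside a graph: soundness

is : ∀ {n} → Type → Fin n → Fm n
is t x = ren (λ _ → x) (typed t)

agree : ∀ {n} → Fin n → Fin n → Fin n → Fm n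
agree y u v = (y ~[ true ] u ∧ᶠ y ~[ true ] v) ∨ᶠ (y ~[ false ] u ∧ᶠ y ~[ false ] v)

-- A vertex x represents the number of vertices of type upT adjacent to it.
zeroᶠ : ∀ {n} → Fin n → Fm n
zeroᶠ x = ∀ᶠ (is upT zero ⇒ zero ~[ false ] suc x)

sucᶠ : ∀ {n} → Fin n → Fin n → Fm n
sucᶠ x x′ = ∃ᶠ (is upT zero ∧ᶠ zero ~[ true ] suc x′ ∧ᶠ zero ~[ false ] suc x ∧ᶠ
  (∀ᶠ (is upT zero ⇒ ¬ᶠ (zero == suc zero) ⇒ agree zero (suc (suc x)) (suc (suc x′)))))

levelᶠ : ∀ {n} → Fin n → Fin n → Fm n
levelᶠ u v = ∀ᶠ (is upT zero ⇒ agree zero (suc u) (suc v))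

-- The table entry of label s contains the pair (i , r).
entryᶠ : ∀ {n} → Fin n → Fin n → Fin n → Fm n
entryᶠ i r s = is numT i ∧ᶠ is numT r ∧ᶠ (∃ᶠ ∃ᶠ ∃ᶠ (
  is (tableT zero) u ∧ᶠ is (tableT (suc zero)) v ∧ᶠ is (tableT (suc (suc zero))) w ∧ᶠ
  levelᶠ u v ∧ᶠ levelᶠ v w ∧ᶠ
  u ~[ true ] (3 ↑ʳ i) ∧ᶠ v ~[ true ] (3 ↑ʳ r) ∧ᶠ w ~[ true ] (3 ↑ʳ s)))
  where
  u v w : ∀ {n} → Fin (3 + n)
  u = suc (suc zero)
  v = suc zero
  w = zero

-- rep f says that variable 0 represents the value of f at the remaining variables. The
-- values computed by a recursion or visited by a search are kept in a table entry.
rep    : ∀ {k} → PR k → Fm (suc k)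
repAll : ∀ {k m n} → Vec (PR k) m → (Fin m → Fin (suc k) → Fin n) → Fm n → Fm n

-- Scope inside `recursionᶠ`, innermost variable first: value and index of the entry at hand, label,
-- result, recursion argument, parameters. For `stepVar` the value and the index of the preceding
-- entry come in front.
baseVar : ∀ {k} → Fin (suc k) → Fin (5 + k)
baseVar zero    = zero
baseVar (suc i) = 5 ↑ʳ i

stepVar : ∀ {k} → Fin (3 + k) → Fin (7 + k)
stepVar zero                = suc (suc zero)
stepVar (suc zero)          = suc zero
stepVar (suc (suc zero))    = zero
stepVar (suc (suc (suc i))) = 7 ↑ʳ i

-- Scope inside `searchᶠ`, innermost variable first: value and index of the entry at hand, the
-- vertex for 0, label, result, parameters.
searchVar : ∀ {k} → Fin (2 + k) → Fin (5 + k)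
searchVar zero          = zero
searchVar (suc zero)    = suc zero
searchVar (suc (suc i)) = 5 ↑ʳ i

recursionᶠ : ∀ {k} → Fm (suc k) → Fm (suc (suc (suc k))) → Fm (suc (suc k))
recursionᶠ f g = ∃ᶠ (entryᶠ (suc (suc zero)) (suc zero) zero ∧ᶠ
  (∀ᶠ ∀ᶠ (entryᶠ (suc zero) zero (suc (suc zero)) ⇒
    (zeroᶠ (suc zero) ∧ᶠ ren baseVar f) ∨ᶠ
    (∃ᶠ ∃ᶠ (sucᶠ (suc zero) (3 ↑ʳ zero) ∧ᶠ entryᶠ (suc zero) zero (4 ↑ʳ zero) ∧ᶠ
      ren stepVar g)))))

searchᶠ : ∀ {k} → Fm (suc (suc k)) → Fm (suc k)
searchᶠ f = ∃ᶠ ∃ᶠ (zeroᶠ zero ∧ᶠ entryᶠ (suc (suc zero)) zero (suc zero) ∧ᶠ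
  (∀ᶠ ∀ᶠ (entryᶠ (suc zero) zero (3 ↑ʳ zero) ⇒
    ren searchVar f ∧ᶠ
    (zeroᶠ (suc zero) ∨ᶠ
     (∃ᶠ ∃ᶠ ∃ᶠ (sucᶠ (suc (suc zero)) (4 ↑ʳ zero) ∧ᶠ
       entryᶠ (suc (suc zero)) (suc zero) (6 ↑ʳ zero) ∧ᶠ sucᶠ zero (suc zero)))))))

argument : ∀ {k m} → Fin m → Fin (suc k) → Fin (m + suc k)
argument {k} {m} j zero    = j ↑ˡ suc k
argument {k} {m} j (suc i) = m ↑ʳ suc i

result : ∀ {k m} → Fin (suc m) → Fin (m + suc k)
result {k} {m} zero    = m ↑ʳ zero
result {k} {m} (suc j) = j ↑ˡ suc k

rep zer        = zeroᶠ zero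
rep succ       = sucᶠ (suc zero) zero
rep (proj i)   = zero == suc i
rep (comp {m = m} f gs) = ∃ⁿ m (repAll gs argument (ren result (rep f)))
rep (prec f g) = recursionᶠ (rep f) (rep g)
rep (mu f)     = searchᶠ (rep f)
repAll []       τ φ = φ
repAll (g ∷ gs) τ φ = ren (τ zero) (rep g) ∧ᶠ repAll gs (τ ∘ suc) φ

module _ (G : Graph) where

  Zero : V G → Set
  Zero x = ∀ y → Typed G upT y → adj G y x ≡ false

  Agree : V G → V G → V G → Set
  Agree y u v = (adj G y u ≡ true × adj G y v ≡ true) ⊎ (adj G y u ≡ false × adj G y v ≡ false)

  Succ : V G → V G → Set
  Succ x x′ = ∃ λ y → Typed G upT y × adj G y x′ ≡ true × adj G y x ≡ false ×
    (∀ z → Typed G upT z → z ≢ y → Agree z x x′)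

  Level : V G → V G → Set
  Level u v = ∀ y → Typed G upT y → Agree y u v

  Entry : V G → V G → V G → Set
  Entry i r s = Typed G numT i × Typed G numT r × ∃ λ u → ∃ λ v → ∃ λ w →
    Typed G (tableT zero) u × Typed G (tableT (suc zero)) v × Typed G (tableT (suc (suc zero))) w ×
    Level u v × Level v w × adj G u i ≡ true × adj G v r ≡ true × adj G w s ≡ true

  below : V G → V G → Bool
  below x y = ⌊ Typed? G upT y ⌋ ∧ adj G y x

  val : V G → ℕ
  val x = count (below x)

  below-typed : ∀ {x y} → Typed G upT y → below x y ≡ adj G y x
  below-typed {x} {y} t with Typed? G upT y
  ... | yes _ = refl
  ... | no ¬t = contradiction t ¬t

  below-untyped : ∀ {x y} → ¬ Typed G upT y → below x y ≡ false
  below-untyped {x} {y} ¬t with Typed? G upT y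
  ... | yes t = contradiction t ¬t
  ... | no _  = refl

  val-zero : ∀ {x} → Zero x → val x ≡ 0
  val-zero {x} z = count-none (below x) λ y → case y (Typed? G upT y)
    where
    case : ∀ y → Dec (Typed G upT y) → below x y ≡ false
    case y (yes t) = trans (below-typed t) (z y t)
    case y (no ¬t) = below-untyped ¬t

  val-suc : ∀ {x x′} → Succ x x′ → val x′ ≡ suc (val x)
  val-suc {x} {x′} (y , t , yx′ , yx , rest) =
    count-insert {p = below x} {q = below x′} y (trans (below-typed t) yx) (trans (below-typed t) yx′)
      λ z z≢y → case z z≢y (Typed? G upT z)
    where
    case : ∀ z → z ≢ y → Dec (Typed G upT z) → below x z ≡ below x′ z
    case z z≢y (no ¬t) = trans (below-untyped ¬t) (sym (below-untyped ¬t))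
    case z z≢y (yes t) with rest z t z≢y
    ... | inj₁ (p , q) = trans (below-typed t) (trans p (sym (trans (below-typed t) q)))
    ... | inj₂ (p , q) = trans (below-typed t) (trans p (sym (trans (below-typed t) q)))

  -- The graph is arbitrary. A table is unfolded by induction on the value of the index: each entry
  -- has index 0 or points to an entry whose index is one less. This yields a derivation whatever
  -- vertex serves as label, and even if several values are stored for one index.
  sound    : ∀ {k} (f : PR k) {ρ : Env G (suc k)} (xs : Vec ℕ k) →
             (∀ i → val (ρ (suc i)) ≡ lookup xs i) → ⟦ rep f ⟧ G ρ → f ⟨ xs ⟩⇓ val (ρ zero)
  soundAll : ∀ {k m n} (gs : Vec (PR k) m) (τ : Fin m → Fin (suc k) → Fin n) (φ : Fm n)
             {ρ : Env G n} (xs : Vec ℕ k) → (∀ j i → val (ρ (τ j (suc i))) ≡ lookup xs i) →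
             ⟦ repAll gs τ φ ⟧ G ρ → (gs ⟨ xs ⟩⇓* tabulate (λ j → val (ρ (τ j zero)))) × ⟦ φ ⟧ G ρ

  sound zer xs q z = subst (zer ⟨ xs ⟩⇓_) (sym (val-zero z)) ev-zer
  sound succ {ρ} (x ∷ []) q s = subst (succ ⟨ x ∷ [] ⟩⇓_)
    (sym (trans (val-suc s) (cong suc (q zero)))) ev-succ
  sound (proj i) xs q eq = subst (proj i ⟨ xs ⟩⇓_) (sym (trans (cong val eq) (q i))) ev-proj
  sound (comp {m = m} f gs) {ρ} xs q (e , s) =
    let d , t = soundAll gs argument _ xs (λ j i → trans (cong val (lookup-++ʳ e ρ (suc i))) (q i)) s
    in subst (comp f gs ⟨ xs ⟩⇓_) (cong val (lookup-++ʳ e ρ zero))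
         (ev-comp d (sound f _ (λ j → sym (lookup∘tabulate _ j)) t))
  sound (prec f g) {ρ} (n ∷ xs) q (s , last , step) =
    go n (ρ (suc zero)) (ρ zero) (q zero) last
    where
    go : ∀ n i r → val i ≡ n → Entry i r s → prec f g ⟨ n ∷ xs ⟩⇓ val r
    go n i r i≡n en with step i r en
    go zero    i r i≡n en | inj₁ (z , t) = ev-prec0 (sound f xs (q ∘ suc) t)
    go (suc n) i r i≡n en | inj₁ (z , t) with () ← trans (sym (val-zero z)) i≡n
    go zero    i r i≡n en | inj₂ (j , r′ , sc , en′ , t) with () ← trans (sym (val-suc sc)) i≡n
    go (suc n) i r i≡n en | inj₂ (j , r′ , sc , en′ , t) =
      ev-precS (go n j r′ j≡n en′)
        (sound g (n ∷ val r′ ∷ xs) (λ { zero → j≡n ; (suc zero) → refl ; (suc (suc i)) → q (suc i) }) t)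
      where j≡n = ℕ.suc-injective (trans (sym (val-suc sc)) i≡n)
  sound (mu f) {ρ} xs q (s , z , isz , last , step) =
    let d , below = go _ (ρ zero) z refl last
    in ev-mu (subst (f ⟨ _ ∷ xs ⟩⇓_) (val-zero isz) d) below
    where
    go : ∀ n i r → val i ≡ n → Entry i r s →
         f ⟨ n ∷ xs ⟩⇓ val r × (∀ m → m < n → Σ ℕ λ v → f ⟨ m ∷ xs ⟩⇓ suc v)
    go n i r i≡n en with step i r en
    go n i r i≡n en | t , inj₁ z =
      sound f (n ∷ xs) (λ { zero → i≡n ; (suc i) → q i }) t ,
      λ m m<n → contradiction (subst (m <_) (trans (sym i≡n) (val-zero z)) m<n) ℕ.n≮0
    go zero i r i≡n en | t , inj₂ (j , r′ , p , sc , _) with () ← trans (sym (val-suc sc)) i≡n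
    go (suc n) i r i≡n en | t , inj₂ (j , r′ , p , sc , en′ , sp) =
      sound f (suc n ∷ xs) (λ { zero → i≡n ; (suc i) → q i }) t , earlier
      where
      ih = go n j r′ (ℕ.suc-injective (trans (sym (val-suc sc)) i≡n)) en′
      earlier : ∀ m → m < suc n → Σ ℕ λ v → f ⟨ m ∷ xs ⟩⇓ suc v
      earlier m (s≤s m≤n) with ℕ.m≤n⇒m<n∨m≡n m≤n
      ... | inj₁ m<n  = proj₂ ih m m<n
      ... | inj₂ refl = val p , subst (f ⟨ n ∷ xs ⟩⇓_) (val-suc sp) (proj₁ ih)
  soundAll []       τ φ xs q s = ev-[] , s
  soundAll (g ∷ gs) τ φ {ρ} xs q (t , s) =
    let ds , u = soundAll gs (τ ∘ suc) φ xs (q ∘ suc) s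
    in ev-∷ (sound g {ρ ∘ τ zero} xs (q zero) t) ds , u

-- Computations inside a graph: completeness

Trace : Set
Trace = List (ℕ × ℕ)

-- `number` is total, but its successor law stops at `size`; `Eventually` makes the size exceed
-- whatever a given computation needs.
record Model : Set where
  field
    graph   : Graph
    number  : ℕ → V graph
    size    : ℕ
    is-zero : Zero graph (number 0)
    is-suc  : ∀ i → suc i < size → Succ graph (number i) (number (suc i))

open Model

-- The second half is about arbitrary vertices because `recursionᶠ` and `searchᶠ` quantify over all
-- entries of a label: a stray entry would have to be justified too.
Tabulates : (M : Model) → V (graph M) → Trace → Set
Tabulates M w t =
  (∀ {i r} → (i , r) ∈ t → Entry (graph M) (number M i) (number M r) w) ×
  (∀ u v → Entry (graph M) u v w → ∃₂ λ i r → (i , r) ∈ t × u ≡ number M i × v ≡ number M r)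

Tabulated : Model → Trace → Set
Tabulated M t = ∃ λ w → Tabulates M w t

-- The filter of properties shared by all models that are large enough and tabulate
-- suitable finitely many traces.
Eventually : (Model → Set) → Set
Eventually P = ∃₂ λ b ts → ∀ M → b ≤ size M → All (Tabulated M) ts → P M

always : ∀ {P} → (∀ M → P M) → Eventually P
always p = 0 , [] , λ M _ _ → p M

eventually-map : ∀ {P Q} → (∀ M → P M → Q M) → Eventually P → Eventually Q
eventually-map f (b , ts , p) = b , ts , λ M l a → f M (p M l a)

eventually-× : ∀ {P Q} → Eventually P → Eventually Q → Eventually (λ M → P M × Q M)
eventually-× (b , ts , p) (c , us , q) = b + c , ts ++ us , λ M l a →
  p M (ℕ.m+n≤o⇒m≤o b l) (All.++⁻ˡ ts a) , q M (ℕ.m+n≤o⇒n≤o b l) (All.++⁻ʳ ts a)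

eventually-< : ∀ {P : ℕ → Model → Set} k → (∀ m → m < k → Eventually (P m)) →
               Eventually (λ M → ∀ m → m < k → P m M)
eventually-< zero    p = always λ M m ()
eventually-< {P} (suc k) p = eventually-map
  (λ M (q , r) m m<1+k → case M q r m (ℕ.m≤n⇒m<n∨m≡n (s≤s⁻¹ m<1+k)))
  (eventually-× (eventually-< k λ m m<k → p m (ℕ.m≤n⇒m≤1+n m<k)) (p k ℕ.≤-refl))
  where
  case : ∀ M → (∀ m → m < k → P m M) → P k M → ∀ m → m < k ⊎ m ≡ k → P m M
  case M q r m (inj₁ m<k)  = q m m<k
  case M q r m (inj₂ refl) = r

eventually-size : ∀ b → Eventually (λ M → b ≤ size M)
eventually-size b = b , [] , λ M l _ → l

eventually-tabulated : ∀ t → Eventually (λ M → Tabulated M t)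
eventually-tabulated t = 0 , t ∷ [] , λ { M _ (p ∷ []) → p }

-- The values found before a search succeeds come indexed by proofs of `m < k`. A function on plain
-- numbers is needed to list them in a trace; it is 0 outside the range.
choose : ∀ {Q : ℕ → ℕ → Set} k → (∀ m → m < k → ∃ (Q m)) → ∃ λ v → ∀ m → m < k → Q m (v m)
choose {Q} k h = (λ m → v m (m ℕ.<? k)) , λ m m<k → q m m<k (m ℕ.<? k)
  where
  v : ∀ m → Dec (m < k) → ℕ
  v m (yes m<k) = proj₁ (h m m<k)
  v m (no _)    = 0
  q : ∀ m → m < k → (d : Dec (m < k)) → Q m (v m d)
  q m m<k (yes p) = proj₂ (h m p)
  q m m<k (no ¬p) = contradiction m<k ¬p

Represents : ∀ {k} → PR k → Vec ℕ k → ℕ → Model → Set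
Represents f xs y M = ∀ (ρ : Env (graph M) _) → ρ zero ≡ number M y →
  (∀ i → ρ (suc i) ≡ number M (lookup xs i)) → ⟦ rep f ⟧ (graph M) ρ

RepresentsAll : ∀ {k m} → Vec (PR k) m → Vec ℕ k → Vec ℕ m → Model → Set
RepresentsAll gs xs ys M = ∀ n τ (φ : Fm n) (ρ : Env (graph M) n) →
  (∀ j → ρ (τ j zero) ≡ number M (lookup ys j)) →
  (∀ j i → ρ (τ j (suc i)) ≡ number M (lookup xs i)) →
  ⟦ φ ⟧ (graph M) ρ → ⟦ repAll gs τ φ ⟧ (graph M) ρ

Justified : ∀ {k} → PR k → PR (suc (suc k)) → Vec ℕ k → Trace → ℕ → ℕ → Model → Set
Justified f g xs t i r M =
  (i ≡ 0 × Represents f xs r M) ⊎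
  (∃₂ λ j r′ → i ≡ suc j × i < size M × (j , r′) ∈ t × Represents g (j ∷ r′ ∷ xs) r M)

-- By induction on the derivation: being finite, it involves finitely many numbers, recursions and
-- searches, so a lower bound on the size and a finite list of traces suffice.
represents     : ∀ {k} {f : PR k} {xs y} → f ⟨ xs ⟩⇓ y → Eventually (Represents f xs y)
representsAll  : ∀ {k m} {gs : Vec (PR k) m} {xs ys} → gs ⟨ xs ⟩⇓* ys → Eventually (RepresentsAll gs xs ys)
represents-suc : ∀ {k} {f : PR k} {xs} → (Σ ℕ λ v → f ⟨ xs ⟩⇓ suc v) →
                 ∃ λ v → Eventually (Represents f xs (suc v))
-- The whole trace is returned, with a justification of every pair in it, so that a single label
-- serves all levels of the recursion.
recursion      : ∀ {k} {f : PR k} {g xs n y} → prec f g ⟨ n ∷ xs ⟩⇓ y →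
                 ∃ λ t → (n , y) ∈ t × Eventually (λ M → ∀ i r → (i , r) ∈ t → Justified f g xs t i r M)

represents-prec : ∀ {k} {f : PR k} {g xs n y} → prec f g ⟨ n ∷ xs ⟩⇓ y →
                  Eventually (Represents (prec f g) (n ∷ xs) y)
represents-prec {f = f} {g} {xs} {n} {y} d with t , last , just ← recursion {f = f} {g} d =
  eventually-map (λ M (j , w , in-w , out-w) ρ q qs →
    w ,
    subst₂ (λ u v → Entry (graph M) u v w) (sym (qs zero)) (sym q) (in-w last) ,
    λ a b en → let i , r , ∈t , a≡ , b≡ = out-w a b en in
      step M w in-w ρ qs a b i r a≡ b≡ (j i r ∈t))
  (eventually-× just (eventually-tabulated t))
  where
  step : ∀ M w {t} → (∀ {i r} → (i , r) ∈ t → Entry (graph M) (number M i) (number M r) w) →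
         (ρ : Env (graph M) _) → (∀ i → ρ (suc i) ≡ number M (lookup (n ∷ xs) i)) →
         ∀ a b i r → a ≡ number M i → b ≡ number M r → Justified f g xs t i r M →
         _
  step M w in-w ρ qs a b i r a≡ b≡ (inj₁ (refl , R)) =
    inj₁ (subst (Zero (graph M)) (sym a≡) (is-zero M) , R _ b≡ (qs ∘ suc))
  step M w in-w ρ qs a b i r a≡ b≡ (inj₂ (j , r′ , refl , i< , ∈t , R)) =
    inj₂ (number M j , number M r′ ,
      subst (Succ (graph M) _) (sym a≡) (is-suc M j i<) , in-w ∈t ,
      R _ b≡ λ { zero → refl ; (suc zero) → refl ; (suc (suc i)) → qs (suc i) })

represents-mu : ∀ {k} {f : PR (suc k)} {xs n} (v : ℕ → ℕ) → Eventually (Represents f (n ∷ xs) 0) →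
                (∀ m → m < n → Eventually (Represents f (m ∷ xs) (suc (v m)))) →
                Eventually (Represents (mu f) xs n)
represents-mu {f = f} {xs} {n} v last below =
  eventually-map (λ M ((w , in-w , out-w) , R , Rs , n< , v<) ρ q qs →
    w , number M 0 , is-zero M ,
    subst (λ u → Entry (graph M) u (number M 0) w) (sym q) (in-w (here refl)) ,
    λ a b en → let i , r , ∈t , a≡ , b≡ = out-w a b en in
      visited M R Rs ρ qs a b i r a≡ b≡ ∈t ,
      predecessor M w in-w n< v< a b i r a≡ b≡ ∈t)
  (eventually-× (eventually-tabulated t) (eventually-× last (eventually-× (eventually-< n below)
    (eventually-× (eventually-size (suc n)) (eventually-< n λ m _ → eventually-size (suc (suc (v m))))))))
  where
  -- The first pair is the zero that is found, the others are the positive values before it. Each is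
  -- given by its predecessor `v m`, which the formula has to exhibit.
  t : Trace
  t = (n , 0) ∷ applyUpTo (λ m → m , suc (v m)) n

  visited : ∀ M → Represents f (n ∷ xs) 0 M → (∀ m → m < n → Represents f (m ∷ xs) (suc (v m)) M) →
            ∀ {w z} (ρ : Env (graph M) _) → (∀ i → ρ (suc i) ≡ number M (lookup xs i)) →
            ∀ a b i r → a ≡ number M i → b ≡ number M r → (i , r) ∈ t →
            ⟦ ren searchVar (rep f) ⟧ (graph M) (extend b (extend a (extend z (extend w ρ))))
  visited M R Rs ρ qs a b i r a≡ b≡ (here refl) = R _ b≡ λ { zero → a≡ ; (suc i) → qs i }
  visited M R Rs ρ qs a b i r a≡ b≡ (there ∈t) with m , m<n , refl ← ∈-applyUpTo⁻ _ ∈t =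
    Rs m m<n _ b≡ λ { zero → a≡ ; (suc i) → qs i }

  in-range : ∀ {i r} → (i , r) ∈ t → i ≤ n
  in-range (here refl) = ℕ.≤-refl
  in-range (there ∈t) with m , m<n , refl ← ∈-applyUpTo⁻ _ ∈t = ℕ.<⇒≤ m<n

  predecessor : ∀ M w → (∀ {i r} → (i , r) ∈ t → Entry (graph M) (number M i) (number M r) w) →
    suc n ≤ size M → (∀ m → m < n → suc (suc (v m)) ≤ size M) →
    ∀ a b i r → a ≡ number M i → b ≡ number M r → (i , r) ∈ t → _
  predecessor M w in-w n< v< a b zero    r a≡ b≡ ∈t = inj₁ (subst (Zero (graph M)) (sym a≡) (is-zero M))
  predecessor M w in-w n< v< a b (suc j) r a≡ b≡ ∈t =
    inj₂ (number M j , number M (suc (v j)) , number M (v j) ,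
      subst (Succ (graph M) _) (sym a≡) (is-suc M j (ℕ.≤-trans (s≤s (in-range ∈t)) n<)) ,
      in-w (there (∈-applyUpTo⁺ (λ m → m , suc (v m)) (in-range ∈t))) ,
      is-suc M (v j) (v< j (in-range ∈t)))

represents ev-zer = always λ M ρ q qs → subst (Zero (graph M)) (sym q) (is-zero M)
represents (ev-succ {x = x}) = eventually-map
  (λ M l ρ q qs → subst₂ (Succ (graph M)) (sym (qs zero)) (sym q) (is-suc M x l)) (eventually-size (suc (suc x)))
represents (ev-proj {i = i}) = always λ M ρ q qs → trans q (sym (qs i))
represents (ev-comp {f = f} {gs = gs} {xs = xs} {ys = ys} ds d) = eventually-map
  (λ M (Rs , R) ρ q qs → let e = number M ∘ lookup ys in
    e , Rs _ argument _ (e ⧺ ρ) (lookup-++ˡ e ρ) (λ j i → trans (lookup-++ʳ e ρ (suc i)) (qs i))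
          (R _ (trans (lookup-++ʳ e ρ zero) q) (lookup-++ˡ e ρ)))
  (eventually-× (representsAll {gs = gs} ds) (represents {f = f} d))
represents {f = prec f g} d@(ev-prec0 _) = represents-prec {f = f} {g} d
represents {f = prec f g} d@(ev-precS _ _) = represents-prec {f = f} {g} d
represents (ev-mu {f = f} {xs = xs} {n = n} d below) =
  let v , h = choose {λ m v → Eventually (Represents f (m ∷ xs) (suc v))} n
                λ m m<n → represents-suc {f = f} (below m m<n)
  in represents-mu {f = f} v (represents {f = f} d) h

representsAll ev-[] = always λ M n τ φ ρ _ _ s → s
representsAll (ev-∷ {g = g} {gs = gs} d ds) = eventually-map
  (λ M (R , Rs) n τ φ ρ q qs s → R _ (q zero) (qs zero) , Rs n (τ ∘ suc) φ ρ (q ∘ suc) (qs ∘ suc) s)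
  (eventually-× (represents {f = g} d) (representsAll {gs = gs} ds))

represents-suc {f = f} (v , d) = v , represents {f = f} d

recursion {f = f} (ev-prec0 {y = y} d) = (0 , y) ∷ [] , here refl ,
  eventually-map (λ { M R i r (here refl) → inj₁ (refl , R) }) (represents {f = f} d)
recursion {f = f} {g} {xs} (ev-precS {n = n} {r = r₀} {y = y} d e)
  with t , last , just ← recursion {f = f} {g} d =
  (suc n , y) ∷ t , here refl ,
  eventually-map
    (λ { M (j , R , l) i r (here refl) → inj₂ (n , r₀ , refl , l , there last , R)
       ; M (j , R , l) i r (there ∈t) → weaken M (j i r ∈t) })
    (eventually-× just (eventually-× (represents {f = g} e) (eventually-size (suc (suc n)))))
  where
  weaken : ∀ M {i r t p} → Justified f g xs t i r M → Justified f g xs (p ∷ t) i r M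
  weaken M (inj₁ p) = inj₁ p
  weaken M (inj₂ (j , r′ , p , l , ∈t , R)) = inj₂ (j , r′ , p , l , there ∈t , R)

-- The graphs

<ᵇ-true : ∀ {m n} → m < n → (m <ᵇ n) ≡ true
<ᵇ-true m<n = Equivalence.to T-≡ (ℕ.<⇒<ᵇ m<n)

<ᵇ-true⁻ : ∀ m n → (m <ᵇ n) ≡ true → m < n
<ᵇ-true⁻ m n p = ℕ.<ᵇ⇒< m n (Equivalence.from T-≡ p)

<ᵇ-false : ∀ m n → n ≤ m → (m <ᵇ n) ≡ false
<ᵇ-false m n n≤m with m <ᵇ n in eq
... | false = refl
... | true  = contradiction (<ᵇ-true⁻ m n eq) (ℕ.≤⇒≯ n≤m)

<ᵇ-false⁻ : ∀ m n → (m <ᵇ n) ≡ false → n ≤ m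
<ᵇ-false⁻ m n p = ℕ.≮⇒≥ λ m<n → contradiction (trans (sym p) (<ᵇ-true m<n)) λ ()

≡ᵇ-true : ∀ n → (n ≡ᵇ n) ≡ true
≡ᵇ-true n = Equivalence.to T-≡ (ℕ.≡⇒≡ᵇ n n refl)

≡ᵇ-true⁻ : ∀ m n → (m ≡ᵇ n) ≡ true → m ≡ n
≡ᵇ-true⁻ m n p = ℕ.≡ᵇ⇒≡ m n (Equivalence.from T-≡ p)

≡ᵇ-false : ∀ m n → m ≢ n → (m ≡ᵇ n) ≡ false
≡ᵇ-false m n m≢n with m ≡ᵇ n in eq
... | false = refl
... | true  = contradiction (≡ᵇ-true⁻ m n eq) m≢n

consecutive : ℕ → ℕ → Bool
consecutive a b = (suc a ≡ᵇ b) ∨ (suc b ≡ᵇ a)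

consecutive⁻ : ∀ a b → consecutive a b ≡ true → suc a ≡ b ⊎ suc b ≡ a
consecutive⁻ a b p with suc a ≡ᵇ b in eq
... | true  = inj₁ (≡ᵇ-true⁻ (suc a) b eq)
... | false = inj₂ (≡ᵇ-true⁻ (suc b) a p)

consecutive-suc : ∀ a → consecutive a (suc a) ≡ true
consecutive-suc a rewrite ≡ᵇ-true a = refl

consecutive-pred : ∀ a → consecutive (suc a) a ≡ true
consecutive-pred a = trans (∨-comm (suc (suc a) ≡ᵇ a) _) (consecutive-suc a)

consecutive-irrefl : ∀ a → consecutive a a ≡ false
consecutive-irrefl a rewrite ≡ᵇ-false (suc a) a ℕ.1+n≢n = refl

-- An initial segment is left along only one edge of a path, so the edge determines its length. Row
-- vertices see initial segments of `up`.
cut-unique : ∀ {a b} k → consecutive a b ≡ true → (a <ᵇ k) ≡ true → (b <ᵇ k) ≡ false → k ≡ suc a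
cut-unique {a} {b} k c p q with consecutive⁻ a b c
... | inj₁ refl = ℕ.≤-antisym (<ᵇ-false⁻ (suc a) k q) (<ᵇ-true⁻ a k p)
... | inj₂ refl = contradiction (ℕ.≤-trans (<ᵇ-false⁻ b k q) (ℕ.n≤1+n b)) (ℕ.<⇒≱ (<ᵇ-true⁻ (suc b) k p))

-- The same for final segments, which are what an `up` vertex sees of the numbers.
cut-unique′ : ∀ {a b} k → consecutive a b ≡ true → (k <ᵇ a) ≡ true → (k <ᵇ b) ≡ false → k ≡ b
cut-unique′ {a} {b} k c p q with consecutive⁻ a b c
... | inj₂ refl = ℕ.≤-antisym (s≤s⁻¹ (<ᵇ-true⁻ k (suc b) p)) (<ᵇ-false⁻ k b q)
... | inj₁ refl = contradiction (ℕ.≤-trans (ℕ.n≤1+n a) (<ᵇ-false⁻ k (suc a) q)) (ℕ.<⇒≱ (<ᵇ-true⁻ k a p))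

injective⇒surjective : ∀ {n} (f : Fin n → Fin n) → (∀ {i j} → f i ≡ f j → i ≡ j) → Surjects f
injective⇒surjective {suc n} f inj y with Fin.any? (λ x → f x Fin.≟ y)
... | yes p = p
... | no ¬p with i , j , i<j , eq ← Fin.pigeonhole (ℕ.n<1+n n)
    (λ x → punchOut {i = y} {f x} (λ p → ¬p (x , sym p))) =
  contradiction (inj (Fin.punchOut-injective (λ p → ¬p (i , sym p)) (λ p → ¬p (j , sym p)) eq)) (Fin.<⇒≢ i<j)

-- There is no slack: n strict increases from at least c already use up the whole interval to c + n.
strict-chain : ∀ n (f : Fin (suc n) → ℕ) c → (∀ i → f (inject₁ i) < f (suc i)) →
               c ≤ f zero → f (fromℕ n) ≤ c + n → ∀ i → f i ≡ c + toℕ i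
strict-chain zero    f c inc lo hi zero = ℕ.≤-antisym hi (subst (_≤ f zero) (sym (ℕ.+-identityʳ c)) lo)
strict-chain (suc n) f c inc lo hi =
  λ { zero → trans (ℕ.≤-antisym (s≤s⁻¹ (ℕ.≤-trans (inc zero)
                (ℕ.≤-reflexive (trans (rest zero) (ℕ.+-identityʳ (suc c)))))) lo)
                   (sym (ℕ.+-identityʳ c))
    ; (suc i) → trans (rest i) (sym (ℕ.+-suc c (toℕ i))) }
  where
  rest : ∀ i → f (suc i) ≡ suc c + toℕ i
  rest = strict-chain n (f ∘ suc) (suc c) (inc ∘ suc) (ℕ.≤-trans (s≤s lo) (inc zero))
           (ℕ.≤-trans hi (ℕ.≤-reflexive (ℕ.+-suc c n)))

even : ℕ → Bool
even zero    = true
even (suc n) = not (even n)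

even-suc : ∀ a → even (suc a) ≢ even a
even-suc a p with even a
even-suc a () | true
even-suc a () | false

-- Row vertices see exactly the up vertices below their own position. The number i is
-- num (1 + i), and num and up are paths; table κ p is adjacent to the number tb κ p.
module Construction (n₂ : ℕ) (tb : Fin 3 → ℕ → ℕ) where

  -- At least 2, because `upT` is the type of `up` 1 to n - 1 and a guard needs a hub of every type.
  n : ℕ
  n = 2 + n₂

  -- The sizes make every position taken: the `up` path has n edges, one for each vertex of a row,
  -- and the `num` path has 1 + n edges, one for each `up` vertex. The ends of `num` do not belong
  -- to its row.
  Main Label : Set
  Main = (Fin 3 × Fin n) ⊎ (Fin (2 + n) ⊎ Fin (1 + n))
  Label = Fin 14 ⊎ Main

  pattern table κ p = inj₁ (κ , p)
  pattern num i = inj₂ (inj₁ i)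
  pattern up j = inj₂ (inj₂ j)

  numTy upTy : ℕ → Type
  numTy zero    = numLo
  numTy (suc i) = if i ≡ᵇ n then numHi else numT
  upTy zero     = upLo
  upTy (suc j)  = if suc j ≡ᵇ n then upHi else upT

  ty : Main → Type
  ty (table κ p) = tableT κ
  ty (num i)     = numTy (toℕ i)
  ty (up j)      = upTy (toℕ j)

  adjM : Main → Main → Bool
  adjM (table κ p) (table κ′ p′) = false
  adjM (table κ p) (num i)       = toℕ i ≡ᵇ suc (tb κ (toℕ p))
  adjM (table κ p) (up j)        = toℕ j <ᵇ suc (toℕ p)
  adjM (num i)     (table κ p)   = toℕ i ≡ᵇ suc (tb κ (toℕ p))
  adjM (num i)     (num i′)      = consecutive (toℕ i) (toℕ i′)
  adjM (num i)     (up j)        = toℕ j <ᵇ toℕ i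
  adjM (up j)      (table κ p)   = toℕ j <ᵇ suc (toℕ p)
  adjM (up j)      (num i)       = toℕ j <ᵇ toℕ i
  adjM (up j)      (up j′)       = consecutive (toℕ j) (toℕ j′)

  adjL : Label → Label → Bool
  adjL (inj₁ i) (inj₁ j) = not ⌊ i Fin.≟ j ⌋
  adjL (inj₁ i) (inj₂ w) = toℕ i <ᵇ toℕ (ty w)
  adjL (inj₂ w) (inj₁ i) = toℕ i <ᵇ toℕ (ty w)
  adjL (inj₂ w) (inj₂ x) = adjM w x

  adjM-irrefl : ∀ w → adjM w w ≡ false
  adjM-irrefl (table κ p) = refl
  adjM-irrefl (num i)     = consecutive-irrefl (toℕ i)
  adjM-irrefl (up j)      = consecutive-irrefl (toℕ j)

  adjL-irrefl : ∀ l → adjL l l ≡ false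
  adjL-irrefl (inj₁ i) with i Fin.≟ i
  ... | yes _  = refl
  ... | no i≢i = contradiction refl i≢i
  adjL-irrefl (inj₂ w) = adjM-irrefl w

  adjM-sym : ∀ w x → adjM w x ≡ adjM x w
  adjM-sym (table κ p) (table κ′ p′) = refl
  adjM-sym (table κ p) (num i)       = refl
  adjM-sym (table κ p) (up j)        = refl
  adjM-sym (num i)     (table κ p)   = refl
  adjM-sym (num i)     (num i′)      = ∨-comm (suc (toℕ i) ≡ᵇ toℕ i′) _
  adjM-sym (num i)     (up j)        = refl
  adjM-sym (up j)      (table κ p)   = refl
  adjM-sym (up j)      (num i)       = refl
  adjM-sym (up j)      (up j′)       = ∨-comm (suc (toℕ j) ≡ᵇ toℕ j′) _

  adjL-sym : ∀ l m → adjL l m ≡ adjL m l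
  adjL-sym (inj₁ i) (inj₁ j) with i Fin.≟ j | j Fin.≟ i
  ... | yes _   | yes _   = refl
  ... | no _    | no _    = refl
  ... | yes i≡j | no j≢i  = contradiction (sym i≡j) j≢i
  ... | no i≢j  | yes j≡i = contradiction (sym j≡i) i≢j
  adjL-sym (inj₁ i) (inj₂ w) = refl
  adjL-sym (inj₂ w) (inj₁ i) = refl
  adjL-sym (inj₂ w) (inj₂ x) = adjM-sym w x

  pred-N : ℕ
  pred-N = 13 + (3 * n + ((2 + n) + (1 + n)))

  labelling : Fin (suc pred-N) ↔ Label
  labelling = (↔-id _ ⊎-↔ ((Fin.*↔× ⊎-↔ Fin.+↔⊎) ↔-∘ Fin.+↔⊎)) ↔-∘ Fin.+↔⊎

  abstract
    dec : Fin (suc pred-N) → Label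
    dec = Inverse.to labelling

    enc : Label → Fin (suc pred-N)
    enc = Inverse.from labelling

    dec-enc : ∀ l → dec (enc l) ≡ l
    dec-enc = Inverse.strictlyInverseˡ labelling

    enc-dec : ∀ v → enc (dec v) ≡ v
    enc-dec = Inverse.strictlyInverseʳ labelling

  dec-injective : ∀ {v w} → dec v ≡ dec w → v ≡ w
  dec-injective {v} {w} p = trans (sym (enc-dec v)) (trans (cong enc p) (enc-dec w))

  G : Graph
  G = record
    { pred-size = pred-N
    ; adj       = λ x y → adjL (dec x) (dec y)
    ; irrefl    = λ x → adjL-irrefl (dec x)
    ; symm      = λ x y → adjL-sym (dec x) (dec y) }

  adj-dec : ∀ {x y l m} → dec x ≡ l → dec y ≡ m → adj G x y ≡ adjL l m
  adj-dec = cong₂ adjL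

  -- A proper colouring with 14 colours. Only clique vertex 8 has colour 8, so it lies in every
  -- 14-clique; as it has no other neighbours, the clique vertices form the only 14-clique.
  colour : Label → ℕ
  colour (inj₁ i)           = toℕ i
  colour (inj₂ (table κ p)) = 9
  colour (inj₂ (num i))     = if even (toℕ i) then 10 else 11
  colour (inj₂ (up j))      = if even (toℕ j) then 12 else 13

  colour<14 : ∀ l → colour l < 14
  colour<14 (inj₁ i)           = Fin.toℕ<n i
  colour<14 (inj₂ (table κ p)) = <ᵇ-true⁻ 9 14 refl
  colour<14 (inj₂ (num i)) with even (toℕ i)
  ... | true  = <ᵇ-true⁻ 10 14 refl
  ... | false = <ᵇ-true⁻ 11 14 refl
  colour<14 (inj₂ (up j)) with even (toℕ j)
  ... | true  = <ᵇ-true⁻ 12 14 refl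
  ... | false = <ᵇ-true⁻ 13 14 refl

  8<colour : ∀ w → 8 < colour (inj₂ w)
  8<colour (table κ p) = <ᵇ-true⁻ 8 9 refl
  8<colour (num i) with even (toℕ i)
  ... | true  = <ᵇ-true⁻ 8 10 refl
  ... | false = <ᵇ-true⁻ 8 11 refl
  8<colour (up j) with even (toℕ j)
  ... | true  = <ᵇ-true⁻ 8 12 refl
  ... | false = <ᵇ-true⁻ 8 13 refl

  consecutive-even : ∀ a b → consecutive a b ≡ true → even a ≢ even b
  consecutive-even a b c with consecutive⁻ a b c
  ... | inj₁ refl = even-suc a ∘ sym
  ... | inj₂ refl = even-suc b

  ty≤8 : ∀ w → toℕ (ty w) ≤ 8
  ty≤8 w = Fin.toℕ≤pred[n] (ty w)

  clique-main : ∀ i w → adjL (inj₁ i) (inj₂ w) ≡ true → toℕ i < 8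
  clique-main i w p = ℕ.≤-trans (<ᵇ-true⁻ (toℕ i) _ p) (ty≤8 w)

  colour-proper : ∀ l m → adjL l m ≡ true → colour l ≢ colour m
  colour-proper (inj₁ i) (inj₁ j) p with i Fin.≟ j
  colour-proper (inj₁ i) (inj₁ j) () | yes _
  ... | no i≢j = i≢j ∘ Fin.toℕ-injective
  colour-proper (inj₁ i) (inj₂ w) p =
    ℕ.<⇒≢ (ℕ.<-trans (clique-main i w p) (8<colour w))
  colour-proper (inj₂ w) (inj₁ i) p =
    ℕ.<⇒≢ (ℕ.<-trans (clique-main i w p) (8<colour w)) ∘ sym
  colour-proper (inj₂ (table κ p)) (inj₂ (num i)) _ with even (toℕ i)
  ... | true  = λ ()
  ... | false = λ ()
  colour-proper (inj₂ (table κ p)) (inj₂ (up j)) _ with even (toℕ j)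
  ... | true  = λ ()
  ... | false = λ ()
  colour-proper (inj₂ (num i)) (inj₂ (table κ p)) _ with even (toℕ i)
  ... | true  = λ ()
  ... | false = λ ()
  colour-proper (inj₂ (up j)) (inj₂ (table κ p)) _ with even (toℕ j)
  ... | true  = λ ()
  ... | false = λ ()
  colour-proper (inj₂ (num i)) (inj₂ (up j)) _ with even (toℕ i) | even (toℕ j)
  ... | true  | true  = λ ()
  ... | true  | false = λ ()
  ... | false | true  = λ ()
  ... | false | false = λ ()
  colour-proper (inj₂ (up j)) (inj₂ (num i)) _ with even (toℕ i) | even (toℕ j)
  ... | true  | true  = λ ()
  ... | true  | false = λ ()
  ... | false | true  = λ ()
  ... | false | false = λ ()
  colour-proper (inj₂ (num i)) (inj₂ (num i′)) c
    with even (toℕ i) | even (toℕ i′) | consecutive-even (toℕ i) (toℕ i′) c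
  ... | true  | true  | ne = contradiction refl ne
  ... | true  | false | _  = λ ()
  ... | false | true  | _  = λ ()
  ... | false | false | ne = contradiction refl ne
  colour-proper (inj₂ (up j)) (inj₂ (up j′)) c
    with even (toℕ j) | even (toℕ j′) | consecutive-even (toℕ j) (toℕ j′) c
  ... | true  | true  | ne = contradiction refl ne
  ... | true  | false | _  = λ ()
  ... | false | true  | _  = λ ()
  ... | false | false | ne = contradiction refl ne

  Ofᵗ : Type → V G → Set
  Ofᵗ t v = ∃ λ w → dec v ≡ inj₂ w × ty w ≡ t

  -- The universal conditions concern every guard, not just the intended one. A guard may permute
  -- the clique, for example the vertices 8 to 13, which have no neighbours outside it; the types
  -- must be shown not to depend on this permutation `σ`.
  module GuardAnalysis (e : Env G K) (guarded : Guard G e) where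

    cliqueColour : Fin 14 → Fin 14
    cliqueColour i = fromℕ< (colour<14 (dec (e (gv i))))

    clique-adj : ∀ {i j} → i ≢ j → adj G (e (gv i)) (e (gv j)) ≡ true
    clique-adj {i} {j} i≢j = trans (proj₁ guarded i j) (distinct (i Fin.≟ j))
      where
      distinct : (d : Dec (i ≡ j)) → not ⌊ d ⌋ ≡ true
      distinct (yes i≡j) = contradiction i≡j i≢j
      distinct (no _)    = refl

    cliqueColour-injective : ∀ {i j} → cliqueColour i ≡ cliqueColour j → i ≡ j
    cliqueColour-injective {i} {j} eq with i Fin.≟ j
    ... | yes i≡j = i≡j
    ... | no i≢j  = contradiction (Fin.fromℕ<-injective (colour (dec (e (gv i)))) (colour (dec (e (gv j))))
                        (colour<14 (dec (e (gv i)))) (colour<14 (dec (e (gv j)))) eq)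
                      (colour-proper (dec (e (gv i))) (dec (e (gv j))) (clique-adj i≢j))

    abstract
      has-colour-8 : ∃ λ i → dec (e (gv i)) ≡ inj₁ (8 ↑ʳ zero)
      has-colour-8 = let i , eq = injective⇒surjective cliqueColour cliqueColour-injective (8 ↑ʳ zero) in
        i , uncoloured (dec (e (gv i))) (trans (sym (Fin.toℕ-fromℕ< (colour<14 (dec (e (gv i)))))) (cong toℕ eq))
        where
        uncoloured : ∀ l → colour l ≡ 8 → l ≡ inj₁ (8 ↑ʳ zero)
        uncoloured (inj₁ c) p = cong inj₁ (Fin.toℕ-injective p)
        uncoloured (inj₂ w) p = contradiction (sym p) (ℕ.<⇒≢ (8<colour w))

      index-of : ∀ i → ∃ λ c → dec (e (gv i)) ≡ inj₁ c
      index-of i = cases (i Fin.≟ proj₁ has-colour-8)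
        where
        adjacent : ∀ l → adjL l (inj₁ (8 ↑ʳ zero)) ≡ true → ∃ λ c → l ≡ inj₁ c
        adjacent (inj₁ c) p = c , refl
        adjacent (inj₂ w) p = contradiction (<ᵇ-true⁻ 8 (toℕ (ty w)) p) (ℕ.≤⇒≯ (ty≤8 w))
        cases : Dec (i ≡ proj₁ has-colour-8) → ∃ λ c → dec (e (gv i)) ≡ inj₁ c
        cases (yes eq) = 8 ↑ʳ zero , trans (cong (dec ∘ e ∘ gv) eq) (proj₂ has-colour-8)
        cases (no ne)  = adjacent (dec (e (gv i)))
          (trans (cong (adjL (dec (e (gv i)))) (sym (proj₂ has-colour-8))) (clique-adj ne))

    σ : Fin 14 → Fin 14
    σ i = proj₁ (index-of i)

    dec-σ : ∀ i → dec (e (gv i)) ≡ inj₁ (σ i)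
    dec-σ i = proj₂ (index-of i)

    σ-injective : ∀ {i j} → σ i ≡ σ j → i ≡ j
    σ-injective {i} {j} eq with i Fin.≟ j
    ... | yes i≡j = i≡j
    ... | no i≢j  = contradiction
      (trans (sym (clique-adj i≢j)) (trans (adj-dec (dec-σ i) (dec-σ j))
        (trans (cong (λ c → adjL (inj₁ (σ i)) (inj₁ c)) (sym eq)) (adjL-irrefl (inj₁ (σ i)))))) λ ()

    abstract
      σ-surjective : Surjects σ
      σ-surjective = injective⇒surjective σ σ-injective

    clique-vertex : ∀ {v c} → dec v ≡ inj₁ c → ∃ λ i → v ≡ e (gv i)
    clique-vertex {v} {c} eq with i , σi≡c ← σ-surjective c =
      i , dec-injective (trans eq (trans (cong inj₁ (sym σi≡c)) (sym (dec-σ i))))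

    typed-main : ∀ {t v} → HasType G e t v →
      ∃ λ w → dec v ≡ inj₂ w × (∀ i → (toℕ (σ i) <ᵇ toℕ (ty w)) ≡ (toℕ i <ᵇ toℕ t))
    typed-main {t} {v} h = cases (dec v) refl
      where
      cases : ∀ l → dec v ≡ l → ∃ λ w → dec v ≡ inj₂ w × (∀ i → (toℕ (σ i) <ᵇ toℕ (ty w)) ≡ (toℕ i <ᵇ toℕ t))
      cases (inj₁ c) eq = let i , p = clique-vertex eq in contradiction p (proj₁ (h i))
      cases (inj₂ w) eq = w , eq , λ i → trans (sym (adj-dec eq (dec-σ i))) (proj₂ (h i))

    hub : Type → Main
    hub t = proj₁ (typed-main {t} (proj₂ guarded t))

    dec-hub : ∀ t → dec (e (hv t)) ≡ inj₂ (hub t)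
    dec-hub t = proj₁ (proj₂ (typed-main {t} (proj₂ guarded t)))

    hub-pattern : ∀ t i → (toℕ (σ i) <ᵇ toℕ (ty (hub t))) ≡ (toℕ i <ᵇ toℕ t)
    hub-pattern t = proj₂ (proj₂ (typed-main {t} (proj₂ guarded t)))

    -- The types of the hubs are strictly increasing and at most 8.
    ty-hub : ∀ t → ty (hub t) ≡ t
    ty-hub t = Fin.toℕ-injective (strict-chain 8 (toℕ ∘ ty ∘ hub) 0 increasing z≤n (ty≤8 (hub (fromℕ 8))) t)
      where
      increasing : ∀ (i : Fin 8) → toℕ (ty (hub (inject₁ i))) < toℕ (ty (hub (suc i)))
      increasing i = ℕ.≤-<-trans
        (<ᵇ-false⁻ (toℕ (σ k)) (toℕ (ty (hub (inject₁ i)))) (trans (hub-pattern (inject₁ i) k)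
          (<ᵇ-false (toℕ k) (toℕ (inject₁ i))
          (ℕ.≤-reflexive (trans (Fin.toℕ-inject₁ i) (sym (Fin.toℕ-↑ˡ i 6)))))))
        (<ᵇ-true⁻ (toℕ (σ k)) (toℕ (ty (hub (suc i))))
          (trans (hub-pattern (suc i) k) (<ᵇ-true {toℕ k} {suc (toℕ i)} (ℕ.≤-reflexive (cong suc (Fin.toℕ-↑ˡ i 6))))))
        where k = i ↑ˡ 6

    -- The permutation need not be determined. The hub of type `t` shows the same pattern as `w` and
    -- truly has type `t`; if two types differ, the clique vertex numbered by the smaller one
    -- separates them, and `σ` reaches it.
    pattern-ty : ∀ t w → (∀ i → (toℕ (σ i) <ᵇ toℕ (ty w)) ≡ (toℕ i <ᵇ toℕ t)) → ty w ≡ t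
    pattern-ty t w h = Fin.toℕ-injective (ℕ.≤-antisym (ℕ.≮⇒≥ (too-large t (ty w) (sym ∘ same)))
                                             (ℕ.≮⇒≥ (too-large (ty w) t same)))
      where
      same : ∀ i → (toℕ (σ i) <ᵇ toℕ (ty w)) ≡ (toℕ (σ i) <ᵇ toℕ t)
      same i = trans (h i) (trans (sym (hub-pattern t i)) (cong (λ s → toℕ (σ i) <ᵇ toℕ s) (ty-hub t)))
      too-large : ∀ s s′ → (∀ i → (toℕ (σ i) <ᵇ toℕ s) ≡ (toℕ (σ i) <ᵇ toℕ s′)) → ¬ (toℕ s < toℕ s′)
      too-large s s′ q s<s′ with i , eq ← σ-surjective (s ↑ˡ 5) =
        contradiction (trans (sym (<ᵇ-false (toℕ (σ i)) (toℕ s) (ℕ.≤-reflexive (sym σi))))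
                        (trans (q i) (<ᵇ-true (subst (_< toℕ s′) (sym σi) s<s′)))) λ ()
        where σi = trans (cong toℕ eq) (Fin.toℕ-↑ˡ s 5)

    HasType⇒Of : ∀ {t v} → HasType G e t v → Ofᵗ t v
    HasType⇒Of {t} {v} h = let w , p , q = typed-main {t} {v} h in w , p , pattern-ty t w q

    Of⇒HasType : ∀ {t v} → Ofᵗ t v → HasType G e t v
    Of⇒HasType {t} {v} (w , p , q) i =
      (λ v≡ → contradiction (trans (sym p) (trans (cong dec v≡) (dec-σ i))) λ ()) ,
      trans (adj-dec p (dec-σ i))
        (trans (cong (λ s → toℕ (σ i) <ᵇ toℕ s) (trans q (sym (ty-hub t)))) (hub-pattern t i))

-- The constructed graphs lie in the class and are complete

inject-or-last : ∀ {k} (i : Fin (suc k)) → (∃ λ j → i ≡ inject₁ j) ⊎ i ≡ fromℕ k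
inject-or-last {zero}  zero    = inj₂ refl
inject-or-last {suc k} zero    = inj₁ (zero , refl)
inject-or-last {suc k} (suc i) with inject-or-last i
... | inj₁ (j , refl) = inj₁ (suc j , refl)
... | inj₂ refl       = inj₂ refl

toℕ-inject₁≢ : ∀ {k} (i : Fin k) → (toℕ (inject₁ i) ≡ᵇ k) ≡ false
toℕ-inject₁≢ {k} i = ≡ᵇ-false (toℕ (inject₁ i)) k λ p →
  ℕ.<⇒≢ (Fin.toℕ<n i) (trans (sym (Fin.toℕ-inject₁ i)) p)

toℕ-fromℕ≡ : ∀ k → (toℕ (fromℕ k) ≡ᵇ k) ≡ true
toℕ-fromℕ≡ k rewrite Fin.toℕ-fromℕ k = ≡ᵇ-true k

module Conditions (n₂ : ℕ) (tb : Fin 3 → ℕ → ℕ) where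
  open Construction n₂ tb

  numTy-inject : (k : Fin n) → numTy (suc (toℕ (inject₁ k))) ≡ numT
  numTy-inject k = cong (λ b → if b then numHi else numT) (toℕ-inject₁≢ k)

  numTy-last : numTy (toℕ (fromℕ (suc n))) ≡ numHi
  numTy-last = cong (λ b → if b then numHi else numT) (toℕ-fromℕ≡ n)

  upTy-inject : (k : Fin (suc n₂)) → upTy (suc (toℕ (inject₁ k))) ≡ upT
  upTy-inject k = cong (λ b → if b then upHi else upT) (toℕ-inject₁≢ k)

  upTy-last : upTy (toℕ (fromℕ n)) ≡ upHi
  upTy-last = cong (λ b → if b then upHi else upT) (toℕ-fromℕ≡ (suc n₂))

  -- Matching at a fixed type recovers the shape of a vertex, which the boolean tests in `ty` hide.
  data View : Main → Type → Set where
    row₀  : ∀ k → View (table zero k) (row zero)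
    row₁  : ∀ k → View (table (suc zero) k) (row (suc zero))
    row₂  : ∀ k → View (table (suc (suc zero)) k) (row (suc (suc zero)))
    row₃  : ∀ k → View (num (suc (inject₁ k))) numT
    upMid : ∀ k → View (up (suc (inject₁ k))) upT
    upMin : View (up zero) upLo
    upMax : View (up (fromℕ n)) upHi
    numMin : View (num zero) numLo
    numMax : View (num (fromℕ (suc n))) numHi

  view : ∀ w → View w (ty w)
  view (table zero k)             = row₀ k
  view (table (suc zero) k)       = row₁ k
  view (table (suc (suc zero)) k) = row₂ k
  view (num zero) = numMin
  view (num (suc i)) with inject-or-last i
  ... | inj₁ (k , refl) = subst (View _) (sym (numTy-inject k)) (row₃ k)
  ... | inj₂ refl       = subst (View _) (sym numTy-last) numMax
  view (up zero) = upMin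
  view (up (suc j)) with inject-or-last j
  ... | inj₁ (k , refl) = subst (View _) (sym (upTy-inject k)) (upMid k)
  ... | inj₂ refl       = subst (View _) (sym upTy-last) upMax

  viewAs : ∀ {w t} → ty w ≡ t → View w t
  viewAs {w} refl = view w

  View-ty : ∀ {w t} → View w t → ty w ≡ t
  View-ty (row₀ k)  = refl
  View-ty (row₁ k)  = refl
  View-ty (row₂ k)  = refl
  View-ty (row₃ k)  = numTy-inject k
  View-ty (upMid k) = upTy-inject k
  View-ty upMin     = refl
  View-ty upMax     = upTy-last
  View-ty numMin    = refl
  View-ty numMax    = numTy-last

  rowMain : Fin 4 → Fin n → Main
  rowMain zero                   k = table zero k
  rowMain (suc zero)             k = table (suc zero) k
  rowMain (suc (suc zero))       k = table (suc (suc zero)) k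
  rowMain (suc (suc (suc zero))) k = num (suc (inject₁ k))

  View-row : ∀ r k → View (rowMain r k) (row r)
  View-row zero                   k = row₀ k
  View-row (suc zero)             k = row₁ k
  View-row (suc (suc zero))       k = row₂ k
  View-row (suc (suc (suc zero))) k = row₃ k

  row⁻ : ∀ r {w} → View w (row r) → ∃ λ k → w ≡ rowMain r k
  row⁻ zero                   (row₀ k) = k , refl
  row⁻ (suc zero)             (row₁ k) = k , refl
  row⁻ (suc (suc zero))       (row₂ k) = k , refl
  row⁻ (suc (suc (suc zero))) (row₃ k) = k , refl

  singleMain : Fin 4 → Main
  singleMain zero                   = up zero
  singleMain (suc zero)             = up (fromℕ n)
  singleMain (suc (suc zero))       = num zero
  singleMain (suc (suc (suc zero))) = num (fromℕ (suc n))

  single⁻ : ∀ s {w} → View w (single s) → w ≡ singleMain s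
  single⁻ zero                   upMin  = refl
  single⁻ (suc zero)             upMax  = refl
  single⁻ (suc (suc zero))       numMin = refl
  single⁻ (suc (suc (suc zero))) numMax = refl

  row-up : ∀ r k j → adjM (rowMain r k) (up j) ≡ (toℕ j <ᵇ suc (toℕ k))
  row-up zero                   k j = refl
  row-up (suc zero)             k j = refl
  row-up (suc (suc zero))       k j = refl
  row-up (suc (suc (suc zero))) k j = cong (λ m → toℕ j <ᵇ suc m) (Fin.toℕ-inject₁ k)

  adj-main : ∀ {x y w z} → dec x ≡ inj₂ w → dec y ≡ inj₂ z → adj G x y ≡ adjM w z
  adj-main = adj-dec

  module _ (e : Env G K) (guarded : Guard G e) where
    open GuardAnalysis e guarded

    typeView : ∀ {t v} → HasType G e t v → ∃ λ w → dec v ≡ inj₂ w × View w t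
    typeView {t} {v} h = let w , p , q = HasType⇒Of {t} {v} h in w , p , viewAs q

    ofView : ∀ {t v w} → dec v ≡ inj₂ w → View w t → HasType G e t v
    ofView {t} {v} {w} p q = Of⇒HasType {t} {v} (w , p , View-ty q)

    hub-single : ∀ s → dec (e (hv (single s))) ≡ inj₂ (singleMain s)
    hub-single s = trans (dec-hub (single s)) (cong inj₂ (single⁻ s (viewAs (ty-hub (single s)))))

    upClass⁻ : ∀ {v} → InClass G upClass e v → ∃ λ j → dec v ≡ inj₂ (up j)
    upClass⁻ {v} (zero , h) with typeView {upT} {v} h
    ... | _ , p , upMid k = _ , p
    upClass⁻ {v} (suc zero , h) with typeView {upLo} {v} h
    ... | _ , p , upMin = _ , p
    upClass⁻ {v} (suc (suc zero) , h) with typeView {upHi} {v} h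
    ... | _ , p , upMax = _ , p

    upClass⁺ : ∀ {v j} → dec v ≡ inj₂ (up j) → InClass G upClass e v
    upClass⁺ {v} {zero} p = suc zero , ofView {upLo} {v} p upMin
    upClass⁺ {v} {suc j} p = cases (inject-or-last j)
      where
      cases : _ → InClass G upClass e v
      cases (inj₁ (k , q)) = zero , ofView {upT} {v} (trans p (cong (λ i → inj₂ (up (suc i))) q)) (upMid k)
      cases (inj₂ q) = suc (suc zero) , ofView {upHi} {v} (trans p (cong (λ i → inj₂ (up (suc i))) q)) upMax

    numClass⁻ : ∀ {v} → InClass G numClass e v → ∃ λ j → dec v ≡ inj₂ (num j)
    numClass⁻ {v} (zero , h) with typeView {numT} {v} h
    ... | _ , p , row₃ k = _ , p
    numClass⁻ {v} (suc zero , h) with typeView {numLo} {v} h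
    ... | _ , p , numMin = _ , p
    numClass⁻ {v} (suc (suc zero) , h) with typeView {numHi} {v} h
    ... | _ , p , numMax = _ , p

    numClass⁺ : ∀ {v j} → dec v ≡ inj₂ (num j) → InClass G numClass e v
    numClass⁺ {v} {zero} p = suc zero , ofView {numLo} {v} p numMin
    numClass⁺ {v} {suc j} p = cases (inject-or-last j)
      where
      cases : _ → InClass G numClass e v
      cases (inj₁ (k , q)) = zero , ofView {numT} {v} (trans p (cong (λ i → inj₂ (num (suc i))) q)) (row₃ k)
      cases (inj₂ q) = suc (suc zero) , ofView {numHi} {v} (trans p (cong (λ i → inj₂ (num (suc i))) q)) numMax

    rowClass⁻ : ∀ r {v} → HasType G e (row r) v → ∃ λ k → dec v ≡ inj₂ (rowMain r k)
    rowClass⁻ r {v} h = let w , p , q = typeView {row r} {v} h ; k , w≡ = row⁻ r q in k , trans p (cong inj₂ w≡)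

    rowClass⁺ : ∀ r {v k} → dec v ≡ inj₂ (rowMain r k) → HasType G e (row r) v
    rowClass⁺ r {v} {k} p = ofView {row r} {v} p (View-row r k)

    rowRigid : ∀ r → ⟦ rigid (rowR r) ⟧ G e
    rowRigid r = ends , flips
      where
      ends : ∀ v → HasType G e (row r) v → adj G v (e (hv upLo)) ≡ true × adj G v (e (hv upHi)) ≡ false
      ends v h = let k , p = rowClass⁻ r {v} h in
        trans (adj-main p (hub-single zero)) (row-up r k zero) ,
        trans (adj-main p (hub-single (suc zero))) (trans (row-up r k (fromℕ n))
          (<ᵇ-false (toℕ (fromℕ n)) (suc (toℕ k)) (subst (suc (toℕ k) ≤_) (sym (Fin.toℕ-fromℕ n)) (Fin.toℕ<n k))))
      position : ∀ {a b x i j k} → dec a ≡ inj₂ (up i) → dec b ≡ inj₂ (up j) → adj G a b ≡ true →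
        dec x ≡ inj₂ (rowMain r k) → adj G x a ≡ true → adj G x b ≡ false → suc (toℕ k) ≡ suc (toℕ i)
      position {i = i} {j} {k} a≡ b≡ ab x≡ xa xb =
        cut-unique {toℕ i} {toℕ j} (suc (toℕ k)) (trans (sym (adj-main a≡ b≡)) ab)
          (trans (sym (trans (adj-main x≡ a≡) (row-up r k i))) xa)
          (trans (sym (trans (adj-main x≡ b≡) (row-up r k j))) xb)
      flips : ∀ a b v w → InClass G upClass e a → InClass G upClass e b → adj G a b ≡ true →
        InClass G (class {0} (λ _ → row r)) e v → InClass G (class {0} (λ _ → row r)) e w →
        adj G v a ≡ true → adj G v b ≡ false → adj G w a ≡ true → adj G w b ≡ false → v ≡ w
      flips a b v w a∈ b∈ ab (_ , v∈) (_ , w∈) va vb wa wb =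
        let i , a≡ = upClass⁻ {a} a∈ ; j , b≡ = upClass⁻ {b} b∈
            k , v≡ = rowClass⁻ r {v} v∈ ; l , w≡ = rowClass⁻ r {w} w∈
            k≡l = Fin.toℕ-injective (ℕ.suc-injective
              (trans (position {a} {b} {v} a≡ b≡ ab v≡ va vb) (sym (position {a} {b} {w} a≡ b≡ ab w≡ wa wb))))
        in dec-injective (trans v≡ (trans (cong (inj₂ ∘ rowMain r) k≡l) (sym w≡)))

    upRigid : ⟦ rigid upR ⟧ G e
    upRigid = ends , flips
      where
      ends : ∀ v → HasType G e upT v → adj G v (e (hv numHi)) ≡ true × adj G v (e (hv numLo)) ≡ false
      ends v h = let j , p = upClass⁻ {v} (zero , h) in
        trans (adj-main p (hub-single (suc (suc (suc zero)))))
          (<ᵇ-true (subst (toℕ j <_) (sym (Fin.toℕ-fromℕ (suc n))) (Fin.toℕ<n j))) ,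
        trans (adj-main p (hub-single (suc (suc zero)))) (<ᵇ-false (toℕ j) 0 z≤n)
      position : ∀ {a b x i j k} → dec a ≡ inj₂ (num i) → dec b ≡ inj₂ (num j) → adj G a b ≡ true →
        dec x ≡ inj₂ (up k) → adj G x a ≡ true → adj G x b ≡ false → toℕ k ≡ toℕ j
      position {i = i} {j} {k} a≡ b≡ ab x≡ xa xb =
        cut-unique′ {toℕ i} {toℕ j} (toℕ k) (trans (sym (adj-main a≡ b≡)) ab)
          (trans (sym (adj-main x≡ a≡)) xa) (trans (sym (adj-main x≡ b≡)) xb)
      flips : ∀ a b v w → InClass G numClass e a → InClass G numClass e b → adj G a b ≡ true →
        InClass G upClass e v → InClass G upClass e w →
        adj G v a ≡ true → adj G v b ≡ false → adj G w a ≡ true → adj G w b ≡ false → v ≡ w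
      flips a b v w a∈ b∈ ab v∈ w∈ va vb wa wb =
        let i , a≡ = numClass⁻ {a} a∈ ; j , b≡ = numClass⁻ {b} b∈
            k , v≡ = upClass⁻ {v} v∈ ; l , w≡ = upClass⁻ {w} w∈
            k≡l = Fin.toℕ-injective
              (trans (position {a} {b} {v} a≡ b≡ ab v≡ va vb) (sym (position {a} {b} {w} a≡ b≡ ab w≡ wa wb)))
        in dec-injective (trans v≡ (trans (cong (λ m → inj₂ (up m)) k≡l) (sym w≡)))

    univ-holds : ⟦ univ ⟧ G e
    univ-holds = (λ v → exhaustive v (dec v) refl) , unique , rowRigid , upRigid
      where
      exhaustive : ∀ v l → dec v ≡ l → (∃ λ i → v ≡ e (gv i)) ⊎ (∃ λ t → HasType G e t v)
      exhaustive v (inj₁ c) p = inj₁ (clique-vertex p)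
      exhaustive v (inj₂ w) p = inj₂ (ty w , Of⇒HasType {ty w} {v} (w , p , refl))
      unique : ∀ s v → HasType G e (single s) v → v ≡ e (hv (single s))
      unique s v h = let w , p , q = typeView {single s} {v} h in
        dec-injective (trans p (trans (cong inj₂ (single⁻ s q)) (sym (hub-single s))))

    rowChained : ∀ r → ⟦ chained (rowR r) ⟧ G e
    rowChained r a a∈ a≢ = let i , a≡ = upClass⁻ {a} a∈ in step i a≡ (inject-or-last i)
      where
      step : ∀ i → dec a ≡ inj₂ (up i) → (∃ λ j → i ≡ inject₁ j) ⊎ i ≡ fromℕ n →
        ∃₂ λ b v → InClass G upClass e b × adj G a b ≡ true ×
        InClass G (class {0} (λ _ → row r)) e v × adj G v a ≡ true × adj G v b ≡ false ×
        (∀ w → InClass G (class {0} (λ _ → row r)) e w → adj G w b ≡ true → adj G w a ≡ true)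
      step i a≡ (inj₂ refl) = ⊥-elim (a≢ (dec-injective (trans a≡ (sym (hub-single (suc zero))))))
      step i a≡ (inj₁ (k , refl)) =
        b , v , upClass⁺ {b} {suc k} b≡ ,
        trans (adj-main a≡ b≡) (trans (cong (λ m → consecutive m (suc (toℕ k))) k≡) (consecutive-suc (toℕ k))) ,
        (zero , rowClass⁺ r {v} {k} v≡) ,
        trans (adj-main v≡ a≡) (trans (row-up r k (inject₁ k)) (<ᵇ-true (s≤s (ℕ.≤-reflexive k≡)))) ,
        trans (adj-main v≡ b≡) (trans (row-up r k (suc k)) (<ᵇ-false (suc (toℕ k)) (suc (toℕ k)) ℕ.≤-refl)) ,
        λ w (_ , w∈) wb → let l , w≡ = rowClass⁻ r {w} w∈ in
          trans (adj-main w≡ a≡) (trans (row-up r l (inject₁ k))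
            (<ᵇ-true (subst (_< suc (toℕ l)) (sym k≡)
              (ℕ.<-trans (ℕ.n<1+n (toℕ k)) (<ᵇ-true⁻ (suc (toℕ k)) (suc (toℕ l))
                (trans (sym (trans (adj-main w≡ b≡) (row-up r l (suc k)))) wb))))))
        where
        b = enc (inj₂ (up (suc k)))
        v = enc (inj₂ (rowMain r k))
        b≡ = dec-enc (inj₂ (up (suc k)))
        v≡ = dec-enc (inj₂ (rowMain r k))
        k≡ = Fin.toℕ-inject₁ k

    upChained : ⟦ chained upR ⟧ G e
    upChained a a∈ a≢ = let i , a≡ = numClass⁻ {a} a∈ in step i a≡
      where
      step : ∀ i → dec a ≡ inj₂ (num i) → ∃₂ λ b v → InClass G numClass e b × adj G a b ≡ true ×
        InClass G upClass e v × adj G v a ≡ true × adj G v b ≡ false ×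
        (∀ w → InClass G upClass e w → adj G w b ≡ true → adj G w a ≡ true)
      step zero    a≡ = ⊥-elim (a≢ (dec-injective (trans a≡ (sym (hub-single (suc (suc zero)))))))
      step (suc k) a≡ =
        b , v , numClass⁺ {b} {inject₁ k} b≡ ,
        trans (adj-main a≡ b≡) (trans (cong (consecutive (suc (toℕ k))) k≡) (consecutive-pred (toℕ k))) ,
        upClass⁺ {v} {k} v≡ ,
        trans (adj-main v≡ a≡) (<ᵇ-true (ℕ.n<1+n (toℕ k))) ,
        trans (adj-main v≡ b≡) (<ᵇ-false (toℕ k) (toℕ (inject₁ k)) (ℕ.≤-reflexive k≡)) ,
        λ w w∈ wb → let j , w≡ = upClass⁻ {w} w∈ in
          trans (adj-main w≡ a≡) (<ᵇ-true (ℕ.m≤n⇒m≤1+n (subst (toℕ j <_) k≡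
            (<ᵇ-true⁻ (toℕ j) (toℕ (inject₁ k)) (trans (sym (adj-main w≡ b≡)) wb)))))
        where
        b = enc (inj₂ (num (inject₁ k)))
        v = enc (inj₂ (up k))
        b≡ = dec-enc (inj₂ (num (inject₁ k)))
        v≡ = dec-enc (inj₂ (up k))
        k≡ = Fin.toℕ-inject₁ k

  univᶜ-holds : ⟦ univᶜ ⟧ G empty-env
  univᶜ-holds = univᶜ-intro G univ-holds

  representative : Type → Main
  representative zero                                      = table zero zero
  representative (suc zero)                                = table (suc zero) zero
  representative (suc (suc zero))                          = table (suc (suc zero)) zero
  representative (suc (suc (suc zero)))                    = num (suc (inject₁ zero))
  representative (suc (suc (suc (suc zero))))              = up (suc (inject₁ zero))
  representative (suc (suc (suc (suc (suc s)))))           = singleMain s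

  ty-representative : ∀ t → ty (representative t) ≡ t
  ty-representative zero                                   = refl
  ty-representative (suc zero)                             = refl
  ty-representative (suc (suc zero))                       = refl
  ty-representative (suc (suc (suc zero)))                 = View-ty (row₃ zero)
  ty-representative (suc (suc (suc (suc zero))))           = View-ty (upMid zero)
  ty-representative (suc (suc (suc (suc (suc zero)))))     = refl
  ty-representative (suc (suc (suc (suc (suc (suc zero)))))) = View-ty upMax
  ty-representative (suc (suc (suc (suc (suc (suc (suc zero))))))) = refl
  ty-representative (suc (suc (suc (suc (suc (suc (suc (suc zero)))))))) = View-ty numMax

  e₀ : Env G K
  e₀ = assemble (enc ∘ inj₁) (enc ∘ inj₂ ∘ representative)

  dec-e₀-gv : ∀ i → dec (e₀ (gv i)) ≡ inj₁ i
  dec-e₀-gv i = trans (cong dec (assemble-gv (enc ∘ inj₁) (enc ∘ inj₂ ∘ representative) i)) (dec-enc (inj₁ i))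

  dec-e₀-hv : ∀ t → dec (e₀ (hv t)) ≡ inj₂ (representative t)
  dec-e₀-hv t = trans (cong dec (assemble-hv (enc ∘ inj₁) (enc ∘ inj₂ ∘ representative) t))
    (dec-enc (inj₂ (representative t)))

  guard₀ : Guard G e₀
  guard₀ =
    (λ i j → adj-dec (dec-e₀-gv i) (dec-e₀-gv j)) ,
    (λ t i → (λ p → contradiction (trans (sym (dec-e₀-hv t)) (trans (cong dec p) (dec-e₀-gv i))) λ ()) ,
             trans (adj-dec (dec-e₀-hv t) (dec-e₀-gv i)) (cong (λ s → toℕ i <ᵇ toℕ s) (ty-representative t)))

  core-holds : ⟦ core ⟧ G empty-env
  core-holds = core-intro G e₀ guard₀ (rowChained e₀ guard₀ , upChained e₀ guard₀)

  typed⁻ : ∀ t {v} → Typed G t v → ∃ λ w → dec v ≡ inj₂ w × View w t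
  typed⁻ t {v} h = let e , g , h = Typed-elim G t v h in typeView e g {t} {v} h

  typed⁺ : ∀ {t v w} → dec v ≡ inj₂ w → View w t → Typed G t v
  typed⁺ {t} {v} p q = Typed-intro G e₀ t v guard₀ (ofView e₀ guard₀ {t} {v} p q)

-- Numbers and table entries in the constructed graphs

clamp : ∀ k → ℕ → Fin (suc k)
clamp k       zero    = zero
clamp zero    (suc i) = zero
clamp (suc k) (suc i) = suc (clamp k i)

toℕ-clamp : ∀ {k i} → i ≤ k → toℕ (clamp k i) ≡ i
toℕ-clamp z≤n       = refl
toℕ-clamp (s≤s i≤k) = cong suc (toℕ-clamp i≤k)

-- This recovers a label from its vertex when only the clamped value is known to be small.
clamp-below : ∀ k i → toℕ (clamp k i) < k → toℕ (clamp k i) ≡ i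
clamp-below k       zero    l = refl
clamp-below zero    (suc i) ()
clamp-below (suc k) (suc i) l = cong suc (clamp-below k i (s≤s⁻¹ l))

module Numbers (n₂ : ℕ) (tb : Fin 3 → ℕ → ℕ) where
  open Construction n₂ tb
  open Conditions n₂ tb

  -- `num (1 + k)` sees the `up` vertices 0 to k, of which `upLo` is not counted, so it represents
  -- k. This fails at k = n, where `upHi` is not counted either; hence the model has size n. Larger
  -- arguments are clamped to keep the function total.
  vertex : ℕ → V G
  vertex k = enc (inj₂ (num (suc (clamp n k))))

  dec-vertex : ∀ k → dec (vertex k) ≡ inj₂ (num (suc (clamp n k)))
  dec-vertex k = dec-enc (inj₂ (num (suc (clamp n k))))

  vertex-unique : ∀ {v i k} → dec v ≡ inj₂ (num (suc i)) → k ≤ n → toℕ i ≡ k → v ≡ vertex k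
  vertex-unique {v} {i} {k} p k≤n i≡k = dec-injective (trans p (trans
    (cong (λ j → inj₂ (num (suc j))) (Fin.toℕ-injective (trans i≡k (sym (toℕ-clamp k≤n))))) (sym (dec-vertex k))))

  vertex-up : ∀ {y j k} → dec y ≡ inj₂ (up j) → k ≤ n → adj G y (vertex k) ≡ (toℕ j <ᵇ suc k)
  vertex-up {y} {j} {k} p k≤n =
    trans (adj-main p (dec-vertex k)) (cong (λ m → toℕ j <ᵇ suc m) (toℕ-clamp k≤n))

  typed-up⁻ : ∀ {y} → Typed G upT y → ∃ λ j → dec y ≡ inj₂ (up (suc j))
  typed-up⁻ {y} h = cases (typed⁻ upT {y} h)
    where
    cases : (∃ λ w → dec y ≡ inj₂ w × View w upT) → ∃ λ j → dec y ≡ inj₂ (up (suc j))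
    cases (_ , p , upMid k) = _ , p

  typed-up⁺ : ∀ j → suc j < n → ∃ λ y → Typed G upT y × ∃ λ i → dec y ≡ inj₂ (up i) × toℕ i ≡ suc j
  typed-up⁺ j j<n =
    enc (inj₂ (up i)) , typed⁺ {upT} {enc (inj₂ (up i))} (dec-enc (inj₂ (up i))) (upMid k) ,
    i , dec-enc (inj₂ (up i)) , cong suc (trans (Fin.toℕ-inject₁ k) (Fin.toℕ-fromℕ< (s≤s⁻¹ j<n)))
    where
    k = fromℕ< (s≤s⁻¹ j<n)
    i = suc (inject₁ k)

  vertex-zero : Zero G (vertex 0)
  vertex-zero y h = let j , p = typed-up⁻ {y} h in
    trans (vertex-up p z≤n) (<ᵇ-false (suc (toℕ j)) 1 (s≤s z≤n))

  vertex-suc : ∀ i → suc i < n → Succ G (vertex i) (vertex (suc i))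
  vertex-suc i i<n =
    let y , h , j , p , j≡ = typed-up⁺ i i<n in
    y , h ,
    trans (vertex-up p (ℕ.<⇒≤ i<n)) (<ᵇ-true (s≤s (ℕ.≤-reflexive j≡))) ,
    trans (vertex-up p i≤n) (<ᵇ-false (toℕ j) (suc i) (ℕ.≤-reflexive (sym j≡))) ,
    λ z hz z≢y → let l , q = typed-up⁻ {z} hz in
      compare z q (ℕ.<-cmp (toℕ l) i) λ l≡i → z≢y (dec-injective (trans q
        (trans (cong (inj₂ ∘ inj₂ ∘ inj₂) (Fin.toℕ-injective (trans (cong suc l≡i) (sym j≡)))) (sym p))))
    where
    i≤n : i ≤ n
    i≤n = ℕ.≤-trans (ℕ.n≤1+n i) (ℕ.<⇒≤ i<n)
    compare : ∀ z {l} → dec z ≡ inj₂ (up (suc l)) → Tri (toℕ l < i) (toℕ l ≡ i) (i < toℕ l) → toℕ l ≢ i →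
              Agree G z (vertex i) (vertex (suc i))
    compare z q (tri< l<i _ _) _ = inj₁ (trans (vertex-up q i≤n) (<ᵇ-true (s≤s l<i)) ,
      trans (vertex-up q (ℕ.<⇒≤ i<n)) (<ᵇ-true (s≤s (ℕ.m≤n⇒m≤1+n l<i))))
    compare z q (tri≈ _ l≡i _) l≢i = contradiction l≡i l≢i
    compare z {l} q (tri> _ _ i<l) _ = inj₂ (trans (vertex-up q i≤n)
      (<ᵇ-false (suc (toℕ l)) (suc i) (s≤s (ℕ.<⇒≤ i<l))) ,
      trans (vertex-up q (ℕ.<⇒≤ i<n)) (<ᵇ-false (suc (toℕ l)) (suc (suc i)) (s≤s i<l)))

  cell : Fin 3 → Fin n → V G
  cell κ p = enc (inj₂ (rowMain (κ ↑ˡ 1) p))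

  dec-cell : ∀ κ p → dec (cell κ p) ≡ inj₂ (rowMain (κ ↑ˡ 1) p)
  dec-cell κ p = dec-enc (inj₂ (rowMain (κ ↑ˡ 1) p))

  typed-cell : ∀ κ p → Typed G (tableT κ) (cell κ p)
  typed-cell κ p = typed⁺ {tableT κ} {cell κ p} (dec-cell κ p) (View-row (κ ↑ˡ 1) p)

  up-row : ∀ {y v j} r p → dec y ≡ inj₂ (up j) → dec v ≡ inj₂ (rowMain r p) → adj G y v ≡ (toℕ j <ᵇ suc (toℕ p))
  up-row {j = j} r p y≡ v≡ = trans (adj-main y≡ v≡) (trans (adjM-sym (up j) (rowMain r p)) (row-up r p j))

  level-cell : ∀ κ κ′ p → Level G (cell κ p) (cell κ′ p)
  level-cell κ κ′ p y h = let j , y≡ = typed-up⁻ {y} h in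
    uniform (up-row (κ ↑ˡ 1) p y≡ (dec-cell κ p)) (up-row (κ′ ↑ˡ 1) p y≡ (dec-cell κ′ p))
    where
    uniform : ∀ {b} → adj G y (cell κ p) ≡ b → adj G y (cell κ′ p) ≡ b → Agree G y (cell κ p) (cell κ′ p)
    uniform {true}  p q = inj₁ (p , q)
    uniform {false} p q = inj₂ (p , q)

  level-unique : ∀ {u v} r s p q → dec u ≡ inj₂ (rowMain r p) → dec v ≡ inj₂ (rowMain s q) → Level G u v → p ≡ q
  level-unique {u} {v} r s p q u≡ v≡ lev = cases (ℕ.<-cmp (toℕ p) (toℕ q))
    where
    sees : ∀ {y i x} t a b → dec y ≡ inj₂ (up i) → toℕ i ≡ toℕ a → dec x ≡ inj₂ (rowMain t b) →
           toℕ a ≤ toℕ b → adj G y x ≡ true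
    sees t a b y≡ i≡ x≡ a≤b = trans (up-row t b y≡ x≡) (<ᵇ-true (s≤s (subst (_≤ toℕ b) (sym i≡) a≤b)))
    misses : ∀ {y i x} t a b → dec y ≡ inj₂ (up i) → toℕ i ≡ toℕ a → dec x ≡ inj₂ (rowMain t b) →
             toℕ b < toℕ a → adj G y x ≡ false
    misses {i = i} t a b y≡ i≡ x≡ b<a = trans (up-row t b y≡ x≡)
      (<ᵇ-false (toℕ i) (suc (toℕ b)) (subst (toℕ b <_) (sym i≡) b<a))
    disagree : ∀ {y x z} → adj G y x ≡ true → adj G y z ≡ false → ¬ (Agree G y x z ⊎ Agree G y z x)
    disagree yx yz (inj₁ (inj₁ (_ , yz′))) with () ← trans (sym yz) yz′
    disagree yx yz (inj₁ (inj₂ (yx′ , _))) with () ← trans (sym yx) yx′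
    disagree yx yz (inj₂ (inj₁ (yz′ , _))) with () ← trans (sym yz) yz′
    disagree yx yz (inj₂ (inj₂ (_ , yx′))) with () ← trans (sym yx) yx′
    -- The larger of two distinct positions is positive and below n, so the `up` vertex there is not
    -- an end. It has type `upT` and can tell the two rows' vertices apart.
    above : ∀ (b : Fin n) {a} → a < toℕ b → ∃ λ y → Typed G upT y × ∃ λ i → dec y ≡ inj₂ (up i) × toℕ i ≡ toℕ b
    above (suc b) _ = typed-up⁺ (toℕ b) (s≤s (Fin.toℕ<n b))
    cases : Tri (toℕ p < toℕ q) (toℕ p ≡ toℕ q) (toℕ q < toℕ p) → p ≡ q
    cases (tri≈ _ p≡q _) = Fin.toℕ-injective p≡q
    cases (tri< p<q _ _) = let y , h , i , y≡ , i≡ = above q p<q in ⊥-elim (disagree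
      (sees s q q y≡ i≡ v≡ ℕ.≤-refl) (misses r q p y≡ i≡ u≡ p<q) (inj₂ (lev y h)))
    cases (tri> _ _ q<p) = let y , h , i , y≡ , i≡ = above p q<p in ⊥-elim (disagree
      (sees r p p y≡ i≡ u≡ ℕ.≤-refl) (misses s p q y≡ i≡ v≡ q<p) (inj₁ (lev y h)))

  table-num : ∀ {u v} κ p {i} → dec u ≡ inj₂ (rowMain (κ ↑ˡ 1) p) → dec v ≡ inj₂ (num i) →
              adj G u v ≡ (toℕ i ≡ᵇ suc (tb κ (toℕ p)))
  table-num zero             p u≡ v≡ = adj-main u≡ v≡
  table-num (suc zero)       p u≡ v≡ = adj-main u≡ v≡
  table-num (suc (suc zero)) p u≡ v≡ = adj-main u≡ v≡

  typed-vertex : ∀ {k} → k < n → Typed G numT (vertex k)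
  typed-vertex {k} k<n = typed⁺ {numT} {vertex k}
    (trans (dec-vertex k) (cong (λ i → inj₂ (num (suc i))) (Fin.toℕ-injective
      (trans (toℕ-clamp (ℕ.<⇒≤ k<n)) (sym (trans (Fin.toℕ-inject₁ (fromℕ< k<n)) (Fin.toℕ-fromℕ< k<n)))))))
    (row₃ (fromℕ< k<n))

  cell-vertex : ∀ κ p → tb κ (toℕ p) < n → adj G (cell κ p) (vertex (tb κ (toℕ p))) ≡ true
  cell-vertex κ p l = trans (table-num κ p (dec-cell κ p) (dec-vertex _))
    (trans (cong (_≡ᵇ tb κ (toℕ p)) (toℕ-clamp (ℕ.<⇒≤ l))) (≡ᵇ-true (tb κ (toℕ p))))

  entry⁺ : ∀ p → (∀ κ → tb κ (toℕ p) < n) →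
           Entry G (vertex (tb zero (toℕ p))) (vertex (tb (suc zero) (toℕ p))) (vertex (tb (suc (suc zero)) (toℕ p)))
  entry⁺ p l = typed-vertex (l zero) , typed-vertex (l (suc zero)) ,
    cell zero p , cell (suc zero) p , cell (suc (suc zero)) p ,
    typed-cell zero p , typed-cell (suc zero) p , typed-cell (suc (suc zero)) p ,
    level-cell zero (suc zero) p , level-cell (suc zero) (suc (suc zero)) p ,
    cell-vertex zero p (l zero) , cell-vertex (suc zero) p (l (suc zero)) ,
    cell-vertex (suc (suc zero)) p (l (suc (suc zero)))

  typed-table⁻ : ∀ κ {v} → Typed G (tableT κ) v → ∃ λ p → dec v ≡ inj₂ (rowMain (κ ↑ˡ 1) p)
  typed-table⁻ κ {v} h = let w , p , q = typed⁻ (tableT κ) {v} h ; k , w≡ = row⁻ (κ ↑ˡ 1) q in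
    k , trans p (cong inj₂ w≡)

  typed-num⁻ : ∀ {v} → Typed G numT v → ∃ λ k → dec v ≡ inj₂ (num (suc (inject₁ k)))
  typed-num⁻ {v} h = let w , p , q = typed⁻ numT {v} h ; k , w≡ = row⁻ (3 ↑ʳ zero) q in
    k , trans p (cong inj₂ w≡)

  -- A table vertex sees `up` vertices as well. Demanding `numT` in an entry leaves the stored
  -- number as the only possible reading.
  read : ∀ κ p {x v} → dec x ≡ inj₂ (rowMain (κ ↑ˡ 1) p) → Typed G numT v → adj G x v ≡ true →
         v ≡ vertex (tb κ (toℕ p))
  read κ p {x} {v} x≡ h xv = let k , v≡ = typed-num⁻ {v} h
                                 k≡ = ℕ.suc-injective (≡ᵇ-true⁻ _ _ (trans (sym (table-num κ p x≡ v≡)) xv)) in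
    vertex-unique v≡ (subst (_≤ n) k≡ (s≤s⁻¹ (Fin.toℕ<n (inject₁ k)))) k≡

  entry⁻ : ∀ u v s → (∀ p → tb (suc (suc zero)) p < n) → Entry G u v (vertex s) → ∃ λ (p : Fin n) →
           u ≡ vertex (tb zero (toℕ p)) × v ≡ vertex (tb (suc zero) (toℕ p)) × s ≡ tb (suc (suc zero)) (toℕ p)
  entry⁻ u v s bounded (hu , hv , x , y , z , hx , hy , hz , xy , yz , xu , yv , zs) =
    let p , x≡ = typed-table⁻ zero {x} hx
        q , y≡ = typed-table⁻ (suc zero) {y} hy
        r , z≡ = typed-table⁻ (suc (suc zero)) {z} hz
        p≡q    = level-unique zero (suc zero) p q x≡ y≡ xy
        q≡r    = level-unique (suc zero) (suc (suc zero)) q r y≡ z≡ yz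
        label  = ℕ.suc-injective (≡ᵇ-true⁻ (suc (toℕ (clamp n s))) (suc (tb (suc (suc zero)) (toℕ r)))
                   (trans (sym (table-num (suc (suc zero)) r z≡ (dec-vertex s))) zs))
    in q , subst (λ o → u ≡ vertex (tb zero (toℕ o))) p≡q (read zero p {x} {u} x≡ hu xu) ,
       read (suc zero) q {y} {v} y≡ hv yv ,
       subst (λ o → s ≡ tb (suc (suc zero)) (toℕ o)) (sym q≡r)
         (trans (sym (clamp-below n s (subst (_< n) (sym label) (bounded (toℕ r))))) label)

  model : Model
  model = record { graph = G ; number = vertex ; size = n ; is-zero = vertex-zero ; is-suc = vertex-suc }

-- Storing a finite list of traces in the table

Record : Set
Record = ℕ × ℕ × ℕ

-- Labels start from 1, since 0 labels the default entry.
records : ℕ → List Trace → List Record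
records ℓ []       = []
records ℓ (t ∷ ts) = List.map (λ (i , r) → i , r , ℓ) t ++ records (suc ℓ) ts

records-label : ∀ ℓ ts {i r s} → (i , r , s) ∈ records ℓ ts → ℓ ≤ s
records-label ℓ (t ∷ ts) ∈r with ∈-++⁻ (List.map _ t) ∈r
... | inj₁ ∈t with _ , _ , refl ← ∈-map⁻ _ ∈t = ℕ.≤-refl
... | inj₂ ∈ts = ℕ.<⇒≤ (records-label (suc ℓ) ts ∈ts)

Labelled : ℕ → List Record → Trace → Set
Labelled ℓ rs t = ∃ λ s → ℓ ≤ s ×
  (∀ {i r} → (i , r) ∈ t → (i , r , s) ∈ rs) × (∀ {i r} → (i , r , s) ∈ rs → (i , r) ∈ t)

labelled : ∀ ℓ ts → All (Labelled ℓ (records ℓ ts)) ts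
labelled ℓ []       = []
labelled ℓ (t ∷ ts) = (ℓ , ℕ.≤-refl , (λ ∈t → ∈-++⁺ˡ (∈-map⁺ _ ∈t)) , first) ∷ All.map later (labelled (suc ℓ) ts)
  where
  first : ∀ {i r} → (i , r , ℓ) ∈ records ℓ (t ∷ ts) → (i , r) ∈ t
  first ∈r with ∈-++⁻ (List.map _ t) ∈r
  ... | inj₁ ∈t with _ , p , refl ← ∈-map⁻ _ ∈t = p
  ... | inj₂ ∈ts = contradiction (records-label (suc ℓ) ts ∈ts) (ℕ.n≮n ℓ)
  later : ∀ {u} → Labelled (suc ℓ) (records (suc ℓ) ts) u → Labelled ℓ (records ℓ (t ∷ ts)) u
  later {u} (s , l , to , from) = s , ℕ.<⇒≤ l , (λ ∈u → ∈-++⁺ʳ _ (to ∈u)) ,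
    λ ∈r → other ∈r (∈-++⁻ (List.map _ t) ∈r)
    where
    other : ∀ {i r} → (i , r , s) ∈ records ℓ (t ∷ ts) → _ → (i , r) ∈ u
    other ∈r (inj₁ ∈t) with _ , _ , refl ← ∈-map⁻ _ ∈t = contradiction l (ℕ.n≮n ℓ)
    other ∈r (inj₂ ∈ts) = from ∈ts

nth : List Record → ℕ → Record
nth []       p       = 0 , 0 , 0
nth (x ∷ xs) zero    = x
nth (x ∷ xs) (suc p) = nth xs p

nth-∈ : ∀ xs p → nth xs p ≡ (0 , 0 , 0) ⊎ nth xs p ∈ xs
nth-∈ []       p       = inj₁ refl
nth-∈ (x ∷ xs) zero    = inj₂ (here refl)
nth-∈ (x ∷ xs) (suc p) with nth-∈ xs p
... | inj₁ eq = inj₁ eq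
... | inj₂ ∈xs = inj₂ (there ∈xs)

∈-nth : ∀ {xs x} → x ∈ xs → ∃ λ p → p < length xs × nth xs p ≡ x
∈-nth (here refl) = 0 , s≤s z≤n , refl
∈-nth (there ∈xs) = let p , l , eq = ∈-nth ∈xs in suc p , s≤s l , eq

component : Fin 3 → Record → ℕ
component zero             (i , r , s) = i
component (suc zero)       (i , r , s) = r
component (suc (suc zero)) (i , r , s) = s

total : List Record → ℕ
total []                 = 0
total ((i , r , s) ∷ xs) = (i + (r + s)) + total xs

component≤total : ∀ κ {xs x} → x ∈ xs → component κ x ≤ total xs
component≤total κ (here {x = i , r , s} refl) = ℕ.≤-trans (part κ) (ℕ.m≤m+n _ _)
  where
  part : ∀ κ → component κ (i , r , s) ≤ i + (r + s)
  part zero             = ℕ.m≤m+n i _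
  part (suc zero)       = ℕ.≤-trans (ℕ.m≤m+n r s) (ℕ.m≤n+m _ i)
  part (suc (suc zero)) = ℕ.≤-trans (ℕ.m≤n+m s r) (ℕ.m≤n+m _ i)
component≤total κ (there ∈xs) = ℕ.≤-trans (component≤total κ ∈xs) (ℕ.m≤n+m _ _)

realise : ∀ {P} → Eventually P → ∀ q → ∃ λ M →
  q ≤ size M × q ≤ pred-size (graph M) ×
  ⟦ univᶜ ⟧ (graph M) empty-env × ⟦ core ⟧ (graph M) empty-env × P M
realise {P} (b , ts , holds) q =
  model ,
  ℕ.≤-trans (ℕ.m≤n+m q _) n₂≤n ,
  ℕ.≤-trans (ℕ.m≤n+m q _) (ℕ.≤-trans n₂≤n n≤pred-N) ,
  Conditions.univᶜ-holds n₂ tb , Conditions.core-holds n₂ tb ,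
  holds model (ℕ.≤-trans b≤n₂ n₂≤n) (All.map tabulated (labelled 1 ts))
  where
  rs = records 1 ts
  tb : Fin 3 → ℕ → ℕ
  tb κ p = component κ (nth rs p)
  -- One summand for each demand: the threshold of the property, numbers large enough for every
  -- component of a record, a position for every record, and the requested size.
  n₂ = ((b + total rs) + length rs) + q
  open Numbers n₂ tb
  open Construction n₂ tb using (n; pred-N; G)

  n₂≤n : n₂ ≤ n
  n₂≤n = ℕ.m≤n+m n₂ 2
  n≤pred-N : n ≤ pred-N
  n≤pred-N = ℕ.≤-trans (ℕ.m≤m+n n _) (ℕ.≤-trans (ℕ.m≤n+m (3 * n) 13) (ℕ.+-monoʳ-≤ 13 (ℕ.m≤m+n (3 * n) _)))
  b≤n₂ : b ≤ n₂
  b≤n₂ = ℕ.≤-trans (ℕ.m≤m+n b _) (ℕ.≤-trans (ℕ.m≤m+n (b + total rs) _) (ℕ.m≤m+n _ q))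

  in-range : ∀ {x} κ → x ∈ rs → component κ x < n
  in-range κ ∈rs = ℕ.≤-<-trans (component≤total κ ∈rs) (ℕ.≤-<-trans
    (ℕ.≤-trans (ℕ.m≤n+m (total rs) b) (ℕ.≤-trans (ℕ.m≤m+n (b + total rs) _) (ℕ.m≤m+n _ q))) (s≤s (ℕ.n≤1+n n₂)))

  length≤n : length rs ≤ n
  length≤n = ℕ.≤-trans (ℕ.≤-trans (ℕ.m≤n+m _ (b + total rs)) (ℕ.m≤m+n _ q)) n₂≤n

  bounded : ∀ p → tb (suc (suc zero)) p < n
  bounded p with nth-∈ rs p
  ... | inj₁ eq  = subst (λ x → component (suc (suc zero)) x < n) (sym eq) (s≤s z≤n)
  ... | inj₂ ∈rs = in-range (suc (suc zero)) ∈rs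

  tabulated : ∀ {t} → Labelled 1 rs t → Tabulated model t
  tabulated {t} (s , 1≤s , to , from) = vertex s , inside , outside
    where
    entry : ∀ {i r} p → p < length rs → nth rs p ≡ (i , r , s) → (i , r , s) ∈ rs →
            Entry G (vertex i) (vertex r) (vertex s)
    entry p p< eq ∈rs = subst (λ (i , r , s) → Entry G (vertex i) (vertex r) (vertex s))
      (trans (cong (nth rs) p≡) eq)
      (entry⁺ p′ λ κ → subst (λ x → component κ x < n) (sym (trans (cong (nth rs) p≡) eq)) (in-range κ ∈rs))
      where
      p′ = fromℕ< (ℕ.≤-trans p< length≤n)
      p≡ = Fin.toℕ-fromℕ< (ℕ.≤-trans p< length≤n)
    inside : ∀ {i r} → (i , r) ∈ t → Entry G (vertex i) (vertex r) (vertex s)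
    inside ∈t = let p , p< , eq = ∈-nth (to ∈t) in entry p p< eq (to ∈t)
    outside : ∀ u v → Entry G u v (vertex s) → ∃₂ λ i r → (i , r) ∈ t × u ≡ vertex i × v ≡ vertex r
    outside u v en =
      let p , u≡ , v≡ , s≡ = entry⁻ u v s bounded en in found p u≡ v≡ s≡ (nth-∈ rs (toℕ p))
      where
      found : ∀ p → u ≡ vertex (tb zero (toℕ p)) → v ≡ vertex (tb (suc zero) (toℕ p)) →
              s ≡ tb (suc (suc zero)) (toℕ p) →
              nth rs (toℕ p) ≡ (0 , 0 , 0) ⊎ nth rs (toℕ p) ∈ rs →
              ∃₂ λ i r → (i , r) ∈ t × u ≡ vertex i × v ≡ vertex r
      found p u≡ v≡ s≡ (inj₁ eq) with () ←
        ℕ.≤-trans 1≤s (ℕ.≤-reflexive (trans s≡ (cong (component (suc (suc zero))) eq)))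
      found p u≡ v≡ s≡ (inj₂ ∈rs) =
        tb zero (toℕ p) , tb (suc zero) (toℕ p) ,
        from (subst (λ s → (tb zero (toℕ p) , tb (suc zero) (toℕ p) , s) ∈ rs) (sym s≡) ∈rs) , u≡ , v≡

-- The diagonal argument

zeroForm : Formula 1
zeroForm = compile (zeroᶠ zero)

sucForm : Formula 2
sucForm = compile (sucᶠ zero (suc zero))

open Numerals zeroForm sucForm

numeral-val : ∀ G {k} a {ρ : Env G (suc k)} → Sat G ρ (numeral a) → val G (ρ zero) ≡ a
numeral-val G zero {ρ} s =
  val-zero G (proj₁ (Sat-compile (zeroᶠ zero)) (proj₁ (Sat-rename (λ _ → refl) zeroForm) s))
numeral-val G (suc a) {ρ} (y , s , t) =
  trans (val-suc G (proj₁ (Sat-compile (sucᶠ zero (suc zero))) (proj₁ (Sat-rename (λ _ → refl) sucForm) s)))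
        (cong suc (numeral-val G a t))

numeral-number : ∀ M {k} a → a < size M → {ρ : Env (graph M) (suc k)} → ρ zero ≡ number M a →
                 Sat (graph M) ρ (numeral a)
numeral-number M zero l eq = proj₂ (Sat-rename (λ _ → refl) zeroForm)
  (proj₂ (Sat-compile (zeroᶠ zero)) (subst (Zero (graph M)) (sym eq) (is-zero M)))
numeral-number M (suc a) l eq =
  number M a ,
  proj₂ (Sat-rename (λ _ → refl) sucForm)
    (proj₂ (Sat-compile (sucᶠ zero (suc zero))) (subst (Succ (graph M) (number M a)) (sym eq) (is-suc M a l))) ,
  numeral-number M a (ℕ.<⇒≤ l) refl

-- Variable 0 represents an argument at which f takes the value 1.
abstract
  yields-one : PR 1 → Fm 1
  yields-one f = ∃ᶠ ∃ᶠ (zeroᶠ (suc zero) ∧ᶠ sucᶠ (suc zero) zero ∧ᶠ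
    ren (λ { zero → zero ; (suc zero) → suc (suc zero) }) (rep f))

  yields-one-sound : ∀ G f {ρ : Env G 1} → ⟦ yields-one f ⟧ G ρ → f ⟨ val G (ρ zero) ∷ [] ⟩⇓ 1
  yields-one-sound G f {ρ} (z , o , hz , ho , r) =
    subst (f ⟨ val G (ρ zero) ∷ [] ⟩⇓_) (trans (val-suc G ho) (cong suc (val-zero G hz)))
      (sound G f (val G (ρ zero) ∷ []) (λ { zero → refl }) r)

  yields-one-holds : ∀ {f a} → f ⟨ a ∷ [] ⟩⇓ 1 →
    Eventually (λ M → ∀ {ρ} → ρ zero ≡ number M a → ⟦ yields-one f ⟧ (graph M) ρ)
  yields-one-holds {f} {a} d = eventually-map
    (λ M (R , l) {ρ} eq → number M 0 , number M 1 , is-zero M , is-suc M 0 l ,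
       R _ refl λ { zero → eq })
    (eventually-× (represents {f = f} d) (eventually-size 2))

  excludes : PR 1 → Fm 1
  excludes f = ¬ᶠ (ren (λ ()) core ∧ᶠ yields-one f)

  excludes-sat : ∀ G f {ρ : Env G 1} →
    Sat G ρ (compile (excludes f)) ⟺ (¬ (⟦ core ⟧ G empty-env × ⟦ yields-one f ⟧ G ρ))
  excludes-sat G f {ρ} =
    (λ s (cr , y) → proj₁ (Sat-compile {G} {ρ = ρ} (excludes f)) s (⟦⟧-cong G (λ ()) core cr , y)) ,
    (λ h → proj₂ (Sat-compile {G} {ρ = ρ} (excludes f)) λ (cr , y) → h (⟦⟧-cong G (λ ()) core cr , y))

univ-sat : ∀ G → Sat G empty-env (compile univᶜ) ⟺ ⟦ univᶜ ⟧ G empty-env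
univ-sat G = Sat-compile univᶜ

module Reduction (c : PR 1) where

  open Diagonal (compile univᶜ) c

  θ : Formula 1
  θ = compile (excludes self-apply)

  φ : Sentence
  φ = fixed-point θ

  a : ℕ
  a = ⌜ θ ⌝

  Witness : Graph → Set
  Witness G = ∃ λ x → Sat G (extend x empty-env) (numeral a) × ⟦ core ⟧ G empty-env ×
    ⟦ yields-one self-apply ⟧ G (extend x empty-env)

  φ⇒univ : ∀ {G} → G ⊨ φ → ⟦ univᶜ ⟧ G empty-env
  φ⇒univ {G} (u , _) = proj₁ (univ-sat G) u

  φ⇒¬Witness : ∀ {G} → G ⊨ φ → ¬ Witness G
  φ⇒¬Witness {G} (_ , s) (x , nm , cr , y) with s x
  ... | inj₁ ¬nm = ¬nm nm
  ... | inj₂ ex  = proj₁ (excludes-sat G self-apply) ex (cr , y)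

  ¬Witness⇒φ : ∀ {G} → ⟦ univᶜ ⟧ G empty-env → ¬ Witness G → G ⊨ φ
  ¬Witness⇒φ {G} u ¬w = proj₂ (univ-sat G) u , λ x → cases x (Sat? G (extend x empty-env) (numeral a))
    where
    cases : ∀ x → Dec (Sat G (extend x empty-env) (numeral a)) →
            Sat G (extend x empty-env) (¬' numeral a) ⊎ Sat G (extend x empty-env) θ
    cases x (no ¬nm) = inj₁ ¬nm
    cases x (yes nm) = inj₂ (proj₂ (excludes-sat G self-apply) λ (cr , y) → ¬w (x , nm , cr , y))

  μ : Sentence
  μ = nnf true (compile univᶜ)

  μ-universal : IsUniversal μ
  μ-universal = nnf-universal true (compile univᶜ) univᶜ-universal

  μ-sat : ∀ G → Sat G empty-env μ ⟺ ⟦ univᶜ ⟧ G empty-env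
  μ-sat G = proj₁ (univ-sat G) ∘ proj₁ (nnf-true (compile univᶜ)) ,
            proj₂ (nnf-true (compile univᶜ)) ∘ proj₂ (univ-sat G)

  univᶜ-≤ind : ∀ {G H} → H ≤ind G → ⟦ univᶜ ⟧ G empty-env → ⟦ univᶜ ⟧ H empty-env
  univᶜ-≤ind {G} {H} e u = proj₁ (μ-sat H) (universal-≤ind e (λ ()) μ-universal (proj₂ (μ-sat G) u))

  -- A witness in `H` includes `core`, so by maximality the embedding is an isomorphism. Then `H`
  -- inherits `φ` from `G`, which rules the witness out.
  φ-closed : ClosedUnderInducedSubgraphs φ
  φ-closed G H e s = ¬Witness⇒φ {H} (univᶜ-≤ind e (φ⇒univ {G} s)) λ w@(_ , _ , cr , _) →
    φ⇒¬Witness {H} (proj₂ (Sat-iso e (core-maximal e (φ⇒univ {G} s) cr) (λ ()) φ) s) w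

  -- The realised graph has a witness while none of its proper induced subgraphs satisfies `core`.
  -- So it is a minimal non-model, and it can be taken larger than any universal sentence allows.
  accepted : c ⟨ code φ ∷ [] ⟩⇓ 1 → ¬ EquivToUniversal φ
  accepted d (ν , ν-universal , eqv) =
    -- The size must exceed `a` for the numeral to denote a vertex, and the quantifier count for
    -- some vertex to lie outside the refutation.
    let M , large , big , u , cr , y = realise (yields-one-holds {self-apply} (self-apply-⇓ θ d))
                                               (suc (a + ∀-count ν-universal))
        G = graph M
    in small-minimal-nonmodels {φ} ν-universal eqv G
      (ℕ.≤-trans (s≤s (ℕ.m≤n+m _ a)) big)
      (λ s → φ⇒¬Witness {G} s (number M a ,
        numeral-number M a (ℕ.≤-trans (s≤s (ℕ.m≤m+n a _)) large) refl , cr , y refl))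
      λ H e proper → ¬Witness⇒φ {H} (univᶜ-≤ind e u) λ (_ , _ , cr′ , _) → proper (core-maximal e u cr′)

  -- By soundness a witness in any graph at all would yield a derivation of output 1, against
  -- determinism. So the second conjunct of `φ` never fails.
  rejected : c ⟨ code φ ∷ [] ⟩⇓ 0 → EquivToUniversal φ
  rejected d = μ , μ-universal , λ G →
    (λ s → proj₂ (μ-sat G) (φ⇒univ {G} s)) ,
    (λ s → ¬Witness⇒φ {G} (proj₁ (μ-sat G) s) λ (x , nm , _ , y) →
      contradiction (⇓-deterministic d (self-apply-⇓⁻ θ
        (subst (λ n → self-apply ⟨ n ∷ [] ⟩⇓ 1) (numeral-val G a nm) (yields-one-sound G self-apply y)))) λ ())

theorem1p2 : ¬ Σ (PR 1) (λ c → DecidesOn c ClosedUnderInducedSubgraphs EquivToUniversal)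
theorem1p2 (c , decides) = verdict (decides φ φ-closed)
  where
  open Reduction c
  verdict : ¬ ((c ⟨ code φ ∷ [] ⟩⇓ 1 × EquivToUniversal φ) ⊎ (c ⟨ code φ ∷ [] ⟩⇓ 0 × ¬ EquivToUniversal φ))
  verdict (inj₁ (d , equiv))  = accepted d equiv
  verdict (inj₂ (d , ¬equiv)) = ¬equiv (rejected d)
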